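{- For every integer $t\geq 2$, the graph $\Gamma_t=\Gamma_{\mathrm{Sh}}\,\square\,K_t$ (the Cartesian product of the Shrikhande graph $\Gamma_{\mathrm{Sh}}$ and the complete graph $K_t$) is connected and sesqui-regular with parameters $(n,k,c)=(16t,\,t+5,\,2)$. Moreover, $\lambda_{\min}(\Gamma_t)=-3$, and $\Gamma_t$ is not $1$-integrable.
   Context: All graphs are finite, undirected and simple. For a graph $G$, $A(G)$ is its adjacency matrix and $\lambda_{\min}(G)$ is the smallest eigenvalue of $A(G)$; $N_G(x)$ is the set of neighbors of $x$ and $\operatorname{dist}_G$ is the graph distance. A $k$-regular graph $G$ on $n$ vertices is sesqui-regular with parameters $(n,k,c)$ if $|N_G(x)\cap N_G(y)|=c$ whenever $\operatorname{dist}_G(x,y)=2$. For a positive integer $s$, a graph $G$ is $s$-integrable if there exists an integral matrix $N$ such that $A(G)+\lceil-\lambda_{\min}(G)\rceil I=\frac1s N^{\mathsf T}N$. The Cartesian product $G\square H$ has vertex set $V(G)\times V(H)$, with $(x,i)$ and $(y,j)$ adjacent precisely when either $x=y$ and $i\sim_H j$, or $i=j$ and $x\sim_G y$. The Shrikhande graph is the Cayley graph $\Gamma_{\mathrm{Sh}}=\operatorname{Cay}(\mathbb Z_4^2,\{\pm(1,0),\pm(0,1),\pm(1,1)\})$ (two elements adjacent iff their difference lies in the given set); it is strongly regular with parameters $(16,6,2,2)$. -}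

module Defs where

open import Algebra.Bundles.Raw using (RawMonoid)
import Algebra.Definitions.RawMonoid as RawMonoidDefs
open import Data.Bool.Base using (if_then_else_)
open import Data.Fin.Base as Fin using (Fin; zero; suc; toℕ)
import Data.Fin.Properties as Fin
open import Data.Integer.Base as ℤ using (ℤ; 0ℤ; 1ℤ)
open import Data.List.Base using (List; []; _∷_; length; filter; map; allFin)
import Data.List.Membership.DecPropositional as DecMembership
open import Data.Nat.Base as ℕ using (ℕ; zero; suc; NonZero)
open import Data.Nat.DivMod using (_mod_)
import Data.Nat.Properties as ℕ
open import Data.Product.Base using (Σ-syntax; ∃-syntax; _×_; _,_; proj₁; proj₂)
open import Data.Product.Function.NonDependent.Propositional using (_×-↔_)
open import Data.Product.Properties using (≡-dec)
open import Data.Rational.Base as ℚ using (ℚ; 0ℚ; 1ℚ; ½; ∣_∣)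
import Data.Rational.Properties as ℚ
open import Data.Rational.Solver using (module +-*-Solver)
open import Data.Sum.Base using (_⊎_; inj₁; inj₂)
open import Function.Bundles using (_↔_; Inverse)
open import Function.Construct.Composition using (_↔-∘_)
open import Function.Construct.Identity using (↔-id)
open import Function.Construct.Symmetry using (↔-sym)
open import Function.Properties.Inverse using (↔⇒↣)
open import Relation.Binary.Construct.Closure.ReflexiveTransitive using (Star; ε; _◅_)
open import Relation.Binary.Definitions using (Decidable; DecidableEquality; Symmetric)
open import Relation.Binary.PropositionalEquality
  using (_≡_; _≢_; refl; sym; trans; cong; subst)
open import Level using (0ℓ)
open import Relation.Nullary using (¬_; does)
open import Relation.Nullary.Decidable
  using (via-injection; from-yes; ¬?; _×-dec_; _⊎-dec_; _→-dec_)

------------------------------------------------------------------------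
-- Real numbers, as Cauchy sequences of rationals modulo _≈_

IsCauchy : (ℕ → ℚ) → Set
IsCauchy x = ∀ e → 0ℚ ℚ.< e →
  ∃[ N ] (∀ m n → N ℕ.≤ m → N ℕ.≤ n → ∣ x m ℚ.- x n ∣ ℚ.< e)

record ℝ : Set where
  constructor mkℝ
  field
    seq    : ℕ → ℚ
    cauchy : IsCauchy seq

open ℝ public

infix 4 _≈_ _≤ℝ_ _<ℝ_

_≈_ : ℝ → ℝ → Set
x ≈ y = ∀ e → 0ℚ ℚ.< e →
  ∃[ N ] (∀ n → N ℕ.≤ n → ∣ seq x n ℚ.- seq y n ∣ ℚ.< e)

_≤ℝ_ : ℝ → ℝ → Set
x ≤ℝ y = ∀ e → 0ℚ ℚ.< e →
  ∃[ N ] (∀ n → N ℕ.≤ n → seq x n ℚ.≤ seq y n ℚ.+ e)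

_<ℝ_ : ℝ → ℝ → Set
x <ℝ y = ∃[ e ] (0ℚ ℚ.< e ×
  (∃[ N ] (∀ n → N ℕ.≤ n → seq x n ℚ.+ e ℚ.≤ seq y n)))

private
  constant : ∀ q → IsCauchy (λ _ → q)
  constant q e e>0 = 0 , λ _ _ _ _ →
    subst (ℚ._< e) (cong ∣_∣ (sym (ℚ.+-inverseʳ q))) e>0

  +-cauchy : ∀ {x y} → IsCauchy x → IsCauchy y → IsCauchy (λ n → x n ℚ.+ y n)
  +-cauchy {x} {y} cx cy e e>0 = N₁ ℕ.⊔ N₂ , λ m n N≤m N≤n → begin-strict
      ∣ (x m ℚ.+ y m) ℚ.- (x n ℚ.+ y n) ∣
        ≡⟨ cong ∣_∣ (regroup (x m) (y m) (x n) (y n)) ⟩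
      ∣ (x m ℚ.- x n) ℚ.+ (y m ℚ.- y n) ∣
        ≤⟨ ℚ.∣p+q∣≤∣p∣+∣q∣ (x m ℚ.- x n) (y m ℚ.- y n) ⟩
      ∣ x m ℚ.- x n ∣ ℚ.+ ∣ y m ℚ.- y n ∣
        <⟨ ℚ.+-mono-<
             (h₁ m n (ℕ.m⊔n≤o⇒m≤o N₁ N₂ N≤m) (ℕ.m⊔n≤o⇒m≤o N₁ N₂ N≤n))
             (h₂ m n (ℕ.m⊔n≤o⇒n≤o N₁ N₂ N≤m) (ℕ.m⊔n≤o⇒n≤o N₁ N₂ N≤n)) ⟩
      ½ ℚ.* e ℚ.+ ½ ℚ.* e
        ≡⟨ trans (sym (ℚ.*-distribʳ-+ e ½ ½)) (ℚ.*-identityˡ e) ⟩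
      e ∎
    where
    open ℚ.≤-Reasoning
    regroup : ∀ a b c d → (a ℚ.+ b) ℚ.- (c ℚ.+ d) ≡ (a ℚ.- c) ℚ.+ (b ℚ.- d)
    regroup = solve 4 (λ a b c d → (a :+ b) :- (c :+ d) := (a :- c) :+ (b :- d)) refl
      where open +-*-Solver
    e/2>0 : 0ℚ ℚ.< ½ ℚ.* e
    e/2>0 = subst (ℚ._< ½ ℚ.* e) (ℚ.*-zeroʳ ½) (ℚ.*-monoʳ-<-pos ½ e>0)
    N₁ = proj₁ (cx _ e/2>0)
    N₂ = proj₁ (cy _ e/2>0)
    h₁ = proj₂ (cx _ e/2>0)
    h₂ = proj₂ (cy _ e/2>0)

  neg-cauchy : ∀ {x} → IsCauchy x → IsCauchy (λ n → ℚ.- x n)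
  neg-cauchy {x} cx e e>0 = proj₁ (cx e e>0) , λ m n N≤m N≤n →
      subst (ℚ._< e) (eq (x m) (x n)) (proj₂ (cx e e>0) m n N≤m N≤n)
    where
    eq : ∀ a b → ∣ a ℚ.- b ∣ ≡ ∣ ℚ.- a ℚ.- ℚ.- b ∣
    eq a b = trans (sym (ℚ.∣-p∣≡∣p∣ (a ℚ.- b))) (cong ∣_∣ (ℚ.neg-distrib-+ a (ℚ.- b)))

  eventually-bounded : ∀ {x} → IsCauchy x →
    ∃[ B ] (0ℚ ℚ.< B × (∃[ N ] (∀ n → N ℕ.≤ n → ∣ x n ∣ ℚ.≤ B)))
  eventually-bounded {x} cx = 1ℚ ℚ.+ ∣ x N ∣ , B>0 , N , λ n N≤n → begin
      ∣ x n ∣                       ≡⟨ cong ∣_∣ (split (x n) (x N)) ⟩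
      ∣ (x n ℚ.- x N) ℚ.+ x N ∣     ≤⟨ ℚ.∣p+q∣≤∣p∣+∣q∣ (x n ℚ.- x N) (x N) ⟩
      ∣ x n ℚ.- x N ∣ ℚ.+ ∣ x N ∣   ≤⟨ ℚ.+-monoˡ-≤ ∣ x N ∣
                                         (ℚ.<⇒≤ (proj₂ (cx 1ℚ 1>0) n N N≤n ℕ.≤-refl)) ⟩
      1ℚ ℚ.+ ∣ x N ∣                ∎
    where
    open ℚ.≤-Reasoning
    1>0 : 0ℚ ℚ.< 1ℚ
    1>0 = ℚ.positive⁻¹ 1ℚ
    N = proj₁ (cx 1ℚ 1>0)
    B>0 : 0ℚ ℚ.< 1ℚ ℚ.+ ∣ x N ∣
    B>0 = ℚ.+-mono-<-≤ 1>0 (ℚ.0≤∣p∣ (x N))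
    split : ∀ a b → a ≡ (a ℚ.- b) ℚ.+ b
    split = solve 2 (λ a b → a := (a :- b) :+ b) refl
      where open +-*-Solver

  divide : ∀ k e → 0ℚ ℚ.< k → 0ℚ ℚ.< e → ∃[ d ] (0ℚ ℚ.< d × k ℚ.* d ≡ e)
  divide k e k>0 e>0 = 1/k ℚ.* e , d>0 , k*d≡e
    where
    instance
      k-pos : ℚ.Positive k
      k-pos = ℚ.positive k>0
      k-nonZero : ℚ.NonZero k
      k-nonZero = ℚ.pos⇒nonZero k
    1/k : ℚ
    1/k = ℚ.1/ k
    d>0 : 0ℚ ℚ.< 1/k ℚ.* e
    d>0 = subst (ℚ._< 1/k ℚ.* e) (ℚ.*-zeroʳ 1/k)
            (ℚ.*-monoʳ-<-pos 1/k {{ℚ.1/pos⇒pos k}} e>0)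
    k*d≡e : k ℚ.* (1/k ℚ.* e) ≡ e
    k*d≡e = trans (sym (ℚ.*-assoc k 1/k e))
              (trans (cong (ℚ._* e) (ℚ.*-inverseʳ k)) (ℚ.*-identityˡ e))

  ∣*∣-bound : ∀ a b {B d} → 0ℚ ℚ.< B → ∣ a ∣ ℚ.≤ B → ∣ b ∣ ℚ.< d →
              ∣ a ℚ.* b ∣ ℚ.< B ℚ.* d
  ∣*∣-bound a b {B} {d} B>0 a≤B b<d = begin-strict
      ∣ a ℚ.* b ∣      ≡⟨ ℚ.∣p*q∣≡∣p∣*∣q∣ a b ⟩
      ∣ a ∣ ℚ.* ∣ b ∣  ≤⟨ ℚ.*-monoʳ-≤-nonNeg ∣ b ∣ {{ℚ.nonNegative (ℚ.0≤∣p∣ b)}} a≤B ⟩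
      B ℚ.* ∣ b ∣      <⟨ ℚ.*-monoʳ-<-pos B {{ℚ.positive B>0}} b<d ⟩
      B ℚ.* d          ∎
    where open ℚ.≤-Reasoning

  product-bound : ∀ a b a′ b′ B C d e → 0ℚ ℚ.< B → 0ℚ ℚ.< C →
    (B ℚ.+ C) ℚ.* d ≡ e → ∣ a ∣ ℚ.≤ B → ∣ b′ ∣ ℚ.≤ C →
    ∣ a ℚ.- a′ ∣ ℚ.< d → ∣ b ℚ.- b′ ∣ ℚ.< d → ∣ a ℚ.* b ℚ.- a′ ℚ.* b′ ∣ ℚ.< e
  product-bound a b a′ b′ B C d e B>0 C>0 Kd≡e a≤B b′≤C Δa Δb = begin-strict
      ∣ a ℚ.* b ℚ.- a′ ℚ.* b′ ∣
        ≡⟨ cong ∣_∣ (regroup a b a′ b′) ⟩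
      ∣ a ℚ.* (b ℚ.- b′) ℚ.+ b′ ℚ.* (a ℚ.- a′) ∣
        ≤⟨ ℚ.∣p+q∣≤∣p∣+∣q∣ (a ℚ.* (b ℚ.- b′)) (b′ ℚ.* (a ℚ.- a′)) ⟩
      ∣ a ℚ.* (b ℚ.- b′) ∣ ℚ.+ ∣ b′ ℚ.* (a ℚ.- a′) ∣
        <⟨ ℚ.+-mono-< (∣*∣-bound a (b ℚ.- b′) B>0 a≤B Δb)
                      (∣*∣-bound b′ (a ℚ.- a′) C>0 b′≤C Δa) ⟩
      B ℚ.* d ℚ.+ C ℚ.* d
        ≡⟨ trans (sym (ℚ.*-distribʳ-+ d B C)) Kd≡e ⟩
      e ∎
    where
    open ℚ.≤-Reasoning
    regroup : ∀ a b a′ b′ →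
      a ℚ.* b ℚ.- a′ ℚ.* b′ ≡ a ℚ.* (b ℚ.- b′) ℚ.+ b′ ℚ.* (a ℚ.- a′)
    regroup = solve 4 (λ a b a′ b′ →
      a :* b :- a′ :* b′ := a :* (b :- b′) :+ b′ :* (a :- a′)) refl
      where open +-*-Solver

  *-cauchy : ∀ {x y} → IsCauchy x → IsCauchy y → IsCauchy (λ n → x n ℚ.* y n)
  *-cauchy {x} {y} cx cy e e>0 =
    let B , B>0 , M₁ , x≤B = eventually-bounded {x} cx
        C , C>0 , M₂ , y≤C = eventually-bounded {y} cy
        d , d>0 , Kd≡e = divide (B ℚ.+ C) e (ℚ.+-mono-< B>0 C>0) e>0
        N₁ , Δx = cx d d>0
        N₂ , Δy = cy d d>0
        M = M₁ ℕ.⊔ M₂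
        N = N₁ ℕ.⊔ N₂
    in M ℕ.⊔ N , λ m n ≤m ≤n →
      let M≤m = ℕ.m⊔n≤o⇒m≤o M N ≤m
          N≤m = ℕ.m⊔n≤o⇒n≤o M N ≤m
          M≤n = ℕ.m⊔n≤o⇒m≤o M N ≤n
          N≤n = ℕ.m⊔n≤o⇒n≤o M N ≤n
      in product-bound (x m) (y m) (x n) (y n) B C d e B>0 C>0 Kd≡e
           (x≤B m (ℕ.m⊔n≤o⇒m≤o M₁ M₂ M≤m))
           (y≤C n (ℕ.m⊔n≤o⇒n≤o M₁ M₂ M≤n))
           (Δx m n (ℕ.m⊔n≤o⇒m≤o N₁ N₂ N≤m) (ℕ.m⊔n≤o⇒m≤o N₁ N₂ N≤n))
           (Δy m n (ℕ.m⊔n≤o⇒n≤o N₁ N₂ N≤m) (ℕ.m⊔n≤o⇒n≤o N₁ N₂ N≤n))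

fromℚ : ℚ → ℝ
fromℚ q = mkℝ (λ _ → q) (constant q)

fromℤ : ℤ → ℝ
fromℤ z = fromℚ (z ℚ./ 1)

0ℝ 1ℝ : ℝ
0ℝ = fromℤ 0ℤ
1ℝ = fromℤ 1ℤ

infixl 6 _+ℝ_ _-ℝ_
infixl 7 _*ℝ_
infix  8 -ℝ_

_+ℝ_ : ℝ → ℝ → ℝ
x +ℝ y = mkℝ (λ n → seq x n ℚ.+ seq y n) (+-cauchy {seq x} {seq y} (cauchy x) (cauchy y))

-ℝ_ : ℝ → ℝ
-ℝ x = mkℝ (λ n → ℚ.- seq x n) (neg-cauchy {seq x} (cauchy x))

_-ℝ_ : ℝ → ℝ → ℝ
x -ℝ y = x +ℝ (-ℝ y)

_*ℝ_ : ℝ → ℝ → ℝ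
x *ℝ y = mkℝ (λ n → seq x n ℚ.* seq y n) (*-cauchy {seq x} {seq y} (cauchy x) (cauchy y))

+ℝ-rawMonoid : RawMonoid 0ℓ 0ℓ
+ℝ-rawMonoid = record { Carrier = ℝ ; _≈_ = _≈_ ; _∙_ = _+ℝ_ ; ε = 0ℝ }

open RawMonoidDefs +ℝ-rawMonoid public using () renaming (sum to sumℝ)
open RawMonoidDefs ℤ.+-0-rawMonoid public using () renaming (sum to sumℤ)

IsCeiling : ℝ → ℤ → Set
IsCeiling x c = x ≤ℝ fromℤ c × fromℤ c -ℝ 1ℝ <ℝ x

------------------------------------------------------------------------
-- Finite simple graphs

record Graph : Set₁ where
  infix 4 _∼_
  field
    Vertex  : Set
    order   : ℕ
    enum    : Fin order ↔ Vertex
    _∼_     : Vertex → Vertex → Set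
    _∼?_    : Decidable _∼_
    ∼-sym   : Symmetric _∼_
    ∼-irrefl : ∀ x → ¬ (x ∼ x)

  vertex : Fin order → Vertex
  vertex = Inverse.to enum

  vertices : List Vertex
  vertices = map vertex (allFin order)

  infix 4 _≟_
  _≟_ : DecidableEquality Vertex
  _≟_ = via-injection (↔⇒↣ (↔-sym enum)) Fin._≟_

  neighbours : Vertex → List Vertex
  neighbours x = filter (x ∼?_) vertices

  commonNeighbours : Vertex → Vertex → List Vertex
  commonNeighbours x y = filter (λ z → (x ∼? z) ×-dec (y ∼? z)) vertices

  Walk : Vertex → Vertex → Set
  Walk = Star _∼_

  walkLength : ∀ {x y} → Walk x y → ℕ
  walkLength ε       = 0
  walkLength (_ ◅ w) = suc (walkLength w)

  Dist : Vertex → Vertex → ℕ → Set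
  Dist x y d = (Σ[ w ∈ Walk x y ] walkLength w ≡ d)
             × (∀ (w : Walk x y) → d ℕ.≤ walkLength w)

  -- The one-vertex graph is connected, the empty graph is not.
  Connected : Set
  Connected = Vertex × (∀ x y → Walk x y)

  adjacencyMatrix : Vertex → Vertex → ℤ
  adjacencyMatrix x y = if does (x ∼? y) then 1ℤ else 0ℤ

  identityMatrix : Vertex → Vertex → ℤ
  identityMatrix x y = if does (x ≟ y) then 1ℤ else 0ℤ

  -- Eigenvalues of the adjacency matrix acting on real vectors.
  IsEigenvalue : ℝ → Set
  IsEigenvalue μ = Σ[ v ∈ (Vertex → ℝ) ]
      (¬ (∀ x → v x ≈ 0ℝ))
    × (∀ x → sumℝ (λ k → fromℤ (adjacencyMatrix x (vertex k)) *ℝ v (vertex k)) ≈ μ *ℝ v x)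

  IsSmallestEigenvalue : ℝ → Set
  IsSmallestEigenvalue θ = IsEigenvalue θ × (∀ μ → IsEigenvalue μ → θ ≤ℝ μ)

record SesquiRegular (G : Graph) (n k c : ℕ) : Set where
  open Graph G
  field
    order≡n : order ≡ n
    regular : ∀ x → length (neighbours x) ≡ k
    sesqui  : ∀ x y → Dist x y 2 → length (commonNeighbours x y) ≡ c

-- θ is λ_min(G) and c = ⌈-λ_min(G)⌉, each given by its defining property; θ is
-- unique up to _≈_, and hence c is unique.
Integrable : (s : ℕ) .{{_ : NonZero s}} → Graph → Set
Integrable s G =
  Σ[ θ ∈ ℝ ] Σ[ c ∈ ℤ ] (IsSmallestEigenvalue θ × IsCeiling (-ℝ θ) c ×
    (Σ[ m ∈ ℕ ] Σ[ N ∈ (Fin m → Vertex → ℤ) ] (∀ x y →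
      (adjacencyMatrix x y ℤ.+ c ℤ.* identityMatrix x y) ℚ./ 1
        ≡ (1ℤ ℚ./ s) ℚ.* (sumℤ (λ i → N i x ℤ.* N i y) ℚ./ 1))))
  where open Graph G

open Graph public using (Connected; IsEigenvalue; IsSmallestEigenvalue)

------------------------------------------------------------------------
-- The graphs Γ_t

infixr 7 _□_

_□_ : Graph → Graph → Graph
G □ H = record
  { Vertex   = G.Vertex × H.Vertex
  ; order    = G.order ℕ.* H.order
  ; enum     = (G.enum ×-↔ H.enum) ↔-∘ Fin.*↔×
  ; _∼_      = λ (x , i) (y , j) → (x ≡ y × i H.∼ j) ⊎ (i ≡ j × x G.∼ y)
  ; _∼?_     = λ (x , i) (y , j) →
      ((x G.≟ y) ×-dec (i H.∼? j)) ⊎-dec ((i H.≟ j) ×-dec (x G.∼? y))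
  ; ∼-sym    = λ { (inj₁ (p , a)) → inj₁ (sym p , H.∼-sym a)
                 ; (inj₂ (p , a)) → inj₂ (sym p , G.∼-sym a) }
  ; ∼-irrefl = λ { (x , i) (inj₁ (_ , a)) → H.∼-irrefl i a
                 ; (x , i) (inj₂ (_ , a)) → G.∼-irrefl x a }
  }
  where
  module G = Graph G
  module H = Graph H

K : ℕ → Graph
K t = record
  { Vertex   = Fin t
  ; order    = t
  ; enum     = ↔-id (Fin t)
  ; _∼_      = _≢_
  ; _∼?_     = λ i j → ¬? (i Fin.≟ j)
  ; ∼-sym    = λ i≢j j≡i → i≢j (sym j≡i)
  ; ∼-irrefl = λ _ i≢i → i≢i refl
  }

ℤ₄ : Set
ℤ₄ = Fin 4

-₄_ : ℤ₄ → ℤ₄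
-₄ a = (4 ℕ.∸ toℕ a) mod 4

_-₄_ : ℤ₄ → ℤ₄ → ℤ₄
a -₄ b = (toℕ a ℕ.+ toℕ (-₄ b)) mod 4

neg² : ℤ₄ × ℤ₄ → ℤ₄ × ℤ₄
neg² (a , b) = -₄ a , -₄ b

_-²_ : ℤ₄ × ℤ₄ → ℤ₄ × ℤ₄ → ℤ₄ × ℤ₄
(a , b) -² (c , d) = a -₄ c , b -₄ d

shrikhandeConnectionSet : List (ℤ₄ × ℤ₄)
shrikhandeConnectionSet =
  e₁ ∷ neg² e₁ ∷ e₂ ∷ neg² e₂ ∷ e₃ ∷ neg² e₃ ∷ []
  where
  e₁ e₂ e₃ : ℤ₄ × ℤ₄
  e₁ = suc zero , zero
  e₂ = zero , suc zero
  e₃ = suc zero , suc zero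

open DecMembership (≡-dec (Fin._≟_ {4}) (Fin._≟_ {4})) using (_∈_; _∈?_)

Shrikhande : Graph
Shrikhande = record
  { Vertex   = ℤ₄ × ℤ₄
  ; order    = 4 ℕ.* 4
  ; enum     = Fin.*↔×
  ; _∼_      = _∼_
  ; _∼?_     = _∼?_
  ; ∼-sym    = λ {(a , b)} {(c , d)} → symmetric a b c d
  ; ∼-irrefl = λ (a , b) → irreflexive a b
  }
  where
  _∼_ : ℤ₄ × ℤ₄ → ℤ₄ × ℤ₄ → Set
  x ∼ y = (x -² y) ∈ shrikhandeConnectionSet

  _∼?_ : Decidable _∼_
  x ∼? y = (x -² y) ∈? shrikhandeConnectionSet

  symmetric : ∀ a b c d → (a , b) ∼ (c , d) → (c , d) ∼ (a , b)
  symmetric = from-yes (Fin.all? λ a → Fin.all? λ b → Fin.all? λ c → Fin.all? λ d →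
    ((a , b) ∼? (c , d)) →-dec ((c , d) ∼? (a , b)))

  irreflexive : ∀ a b → ¬ ((a , b) ∼ (a , b))
  irreflexive = from-yes (Fin.all? λ a → Fin.all? λ b → ¬? ((a , b) ∼? (a , b)))

Γ : ℕ → Graph
Γ t = Shrikhande □ K t

{-# OPTIONS --safe #-}

-- For the eigenvalue: if A is the adjacency matrix of the Shrikhande graph, then 2(A + 2I) is the sum
-- of w wᵀ over seven explicit functions w on ℤ₄², so A(Γ_t) + 3I = (A + 2I) ⊗ I + I ⊗ J is a sum of
-- squares; an alternating function on a 4-cycle tensored with (1 , -1 , 0 , …) is annihilated.
--
-- For integrality, suppose A(Γ_t) + 3I = NᵀN and let a_x, b_x be the columns of N in two copies of the
-- Shrikhande graph. Then d_x = a_x - b_x has Gram matrix 2(A + 2I), a √2-multiple of the root lattice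
-- E₇, while s_x = a_x + b_x has Gram matrix 2(A + 4I), is orthogonal to all d_y, and is congruent to
-- d_x modulo 2. The d_x yield seven pairwise orthogonal integral vectors of norm 4 whose coordinates
-- modulo 2 form words of the Hamming code. A word of weight 4 leaves no room for s_x at its
-- coordinate, and at the coordinates with words of weight 3 all s_x are proportional to one vector
-- (±1 , ±1 , ±1 , ±1). Hence s_x · s_y is divisible by 4, although it is 2 for adjacent x and y.

module Submission where

open import Defs using (Graph; _□_; K)
open import Algebra.Bundles using (CommutativeRing; Semiring)
import Algebra.Properties.Semiring.Sum as SemiringSum
open import Data.Bool.Base using (Bool; true; false; if_then_else_; _∧_; _∨_; not)
import Data.Bool.Properties as Bool
open import Data.Empty using (⊥)
open import Data.Fin.Base using (Fin; zero; suc; _↑ˡ_; _↑ʳ_; remQuot; combine)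
open import Data.Fin.Patterns
import Data.Fin.Properties as Fin
open import Data.Integer.Base as ℤ using (ℤ; 0ℤ; 1ℤ; -[1+_])
open import Data.Integer.Divisibility.Signed using (_∣_; divides; _∣?_; ∣m∣n⇒∣m+n; ∣m∣n⇒∣m-n; ∣m⇒∣m*n; ∣n⇒∣m*n)
import Data.Integer.DivMod as ℤ
import Data.Integer.Properties as ℤ
open import Data.Integer.Tactic.RingSolver using (solve-∀)
open import Data.List.Base using (filter; length; tabulate)
open import Data.List.Properties using (map-tabulate)
open import Data.Nat.Base as ℕ using (ℕ; zero; suc; _⊔_; s≤s)
import Data.Nat.Properties as ℕ
open import Data.Product.Base using (_×_; _,_; ∃-syntax; proj₁; proj₂)
open import Data.Rational.Base using (ℚ; 0ℚ; 1ℚ; ½; ∣_∣; nonNegative; nonPositive; positive)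
import Data.Rational.Properties as ℚ
open import Data.Rational.Solver using (module +-*-Solver)
import Data.Rational.Unnormalised.Base as ℚᵘ
import Data.Rational.Unnormalised.Properties as ℚᵘ
open import Data.Sum.Base as Sum using (_⊎_; inj₁; inj₂; [_,_]′)
open import Data.Vec.Base using ([]; _∷_; lookup)
open import Data.Vec.Functional using (Vector)
open import Function.Base using (_∘_)
open import Function.Bundles using (Inverse)
open import Relation.Binary.Construct.Closure.ReflexiveTransitive using (ε; _◅_; _◅◅_; gmap)
open import Relation.Binary.PropositionalEquality as ≡ using (_≡_)
open import Relation.Nullary using (¬_; does; yes; no; contradiction; Dec)
open import Relation.Nullary.Decidable using (from-yes; from-no; dec-true; dec-false; ¬?; _×-dec_; _→-dec_)
open import Relation.Unary using (Decidable)

-- Finite sums over index sets and vertex sets.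

module FiniteSums {c ℓ} (R : Semiring c ℓ) where
  open Semiring R
  open SemiringSum R public

  𝟙 : ∀ {n} → Fin n → Fin n → Carrier
  𝟙 i j = if does (i Fin.≟ j) then 1# else 0#

  𝟙-refl : ∀ {n} (i : Fin n) → 𝟙 i i ≡ 1#
  𝟙-refl i = ≡.cong (if_then 1# else 0#) (dec-true (i Fin.≟ i) ≡.refl)

  sum-cong : ∀ {n} {f g : Fin n → Carrier} → (∀ i → f i ≈ g i) → sum f ≈ sum g
  sum-cong = sum-cong-≋

  sum-𝟙 : ∀ {n} i (f : Fin n → Carrier) → sum (λ j → 𝟙 i j * f j) ≈ f i
  sum-𝟙 {suc n} zero f = trans
    (+-cong (*-identityˡ _) (trans (sum-cong (λ j → zeroˡ (f (suc j)))) (sum-replicate-zero n)))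
    (+-identityʳ _)
  sum-𝟙 {suc n} (suc i) f = trans
    (+-cong (zeroˡ _) (sum-𝟙 i (f ∘ suc)))
    (+-identityˡ _)

  sum-++ : ∀ m {n} (f : Fin (m ℕ.+ n) → Carrier) →
    sum f ≈ sum (λ i → f (i ↑ˡ n)) + sum (λ j → f (m ↑ʳ j))
  sum-++ zero    f = sym (+-identityˡ _)
  sum-++ (suc m) f = trans (+-congˡ (sum-++ m (f ∘ suc))) (sym (+-assoc _ _ _))

  sum-combine : ∀ m n (f : Fin (m ℕ.* n) → Carrier) →
    sum f ≈ sum (λ i → sum (λ j → f (combine {m} i j)))
  sum-combine zero    n f = refl
  sum-combine (suc m) n f = trans (sum-++ n f) (+-congˡ (sum-combine m n (λ k → f (n ↑ʳ k))))

  sum-remQuot : ∀ m n (f : Fin m × Fin n → Carrier) →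
    sum (f ∘ remQuot {m} n) ≈ sum (λ i → sum (λ j → f (i , j)))
  sum-remQuot m n f = trans (sum-combine m n _)
    (sum-cong λ i → sum-cong λ j → reflexive (≡.cong f (Fin.remQuot-combine i j)))

  module GraphSums (G : Graph) where
    open Graph G using (Vertex; vertex; enum) renaming (_≟_ to _≟ᵍ_)

    id# : Vertex → Vertex → Carrier
    id# x y = if does (x ≟ᵍ y) then 1# else 0#

    sum-id# : ∀ x (f : Vertex → Carrier) → sum (λ k → id# x (vertex k) * f (vertex k)) ≈ f x
    sum-id# x f = trans
      -- Vertices are compared through their indices under `from enum`; once the index of `vertex k`
      -- is rewritten to `k`, the summand has the form of `sum-𝟙`.
      (sum-cong λ k → reflexive (≡.cong (λ j → (if does (Inverse.from enum x Fin.≟ j) then 1# else 0#) * f (vertex k))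
                                  (Inverse.strictlyInverseʳ enum k)))
      (trans (sum-𝟙 (Inverse.from enum x) (λ k → f (vertex k)))
             (reflexive (≡.cong f (Inverse.strictlyInverseˡ enum x))))

  sum-□K : ∀ G t (f : Graph.Vertex (G □ K t) → Carrier) →
    sum (λ k → f (Graph.vertex (G □ K t) k)) ≈ sum (λ x → sum (λ i → f (Graph.vertex G x , i)))
  sum-□K G t f = sum-remQuot (Graph.order G) t (λ (k , i) → f (Graph.vertex G k , i))

open import Defs
open import Relation.Binary.PropositionalEquality

-- The adjacency matrix of `Γ t` in blocks.

private
  module S = Graph Shrikhande
  module G t = Graph (Γ t)

identity-≡ : (G : Graph) (x : Graph.Vertex G) → Graph.identityMatrix G x x ≡ 1ℤ
identity-≡ G x = cong (if_then 1ℤ else 0ℤ) (dec-true (Graph._≟_ G x x) refl)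

identity-≢ : (G : Graph) (x y : Graph.Vertex G) → x ≢ y → Graph.identityMatrix G x y ≡ 0ℤ
identity-≢ G x y x≢y = cong (if_then 1ℤ else 0ℤ) (dec-false (Graph._≟_ G x y) x≢y)

identity-copy : ∀ t x y i → G.identityMatrix t (x , i) (y , i) ≡ S.identityMatrix x y
identity-copy t x y i with x S.≟ y
... | yes refl = trans (identity-≡ (Γ t) (x , i)) (sym (identity-≡ Shrikhande x))
... | no x≢y = trans (identity-≢ (Γ t) (x , i) (y , i) (λ eq → x≢y (cong proj₁ eq))) (sym (identity-≢ Shrikhande x y x≢y))

-- Together with `adjacency-copies` this is A(Γ_t) = A ⊗ I + I ⊗ (J - I), with A the adjacency
-- matrix of the Shrikhande graph.
adjacency-copy : ∀ t x y i → G.adjacencyMatrix t (x , i) (y , i) ≡ S.adjacencyMatrix x y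
adjacency-copy t x y i rewrite dec-true (i Fin.≟ i) refl | Bool.∧-zeroʳ (does (x S.≟ y)) = refl

adjacency-copies : ∀ t x y {i j} → i ≢ j → G.adjacencyMatrix t (x , i) (y , j) ≡ S.identityMatrix x y
adjacency-copies t x y {i} {j} i≢j rewrite dec-false (i Fin.≟ j) i≢j
  | Bool.∧-identityʳ (does (x S.≟ y)) | Bool.∨-identityʳ (does (x S.≟ y)) = refl

-- Connectedness and vertex counts

module Combinatorics where
  open import Data.Nat.Base using (_+_; _*_)
  open FiniteSums ℕ.+-*-semiring
  open GraphSums Shrikhande
  open ≡-Reasoning

  ⟦_⟧ : Bool → ℕ
  ⟦ b ⟧ = if b then 1 else 0

  length-filter : ∀ {A : Set} {P : A → Set} (P? : Decidable P) {n} (g : Fin n → A) →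
    length (filter P? (tabulate g)) ≡ sum (λ k → ⟦ does (P? (g k)) ⟧)
  length-filter P? {zero} g = refl
  length-filter P? {suc n} g with does (P? (g 0F))
  ... | true  = cong suc (length-filter P? (g ∘ suc))
  ... | false = length-filter P? (g ∘ suc)

  length-filter-vertices : ∀ G {P : Graph.Vertex G → Set} (P? : Decidable P) →
    length (filter P? (Graph.vertices G)) ≡ sum (λ k → ⟦ does (P? (Graph.vertex G k)) ⟧)
  length-filter-vertices G P? = trans (cong (length ∘ filter P?) (map-tabulate (λ k → k) (Graph.vertex G)))
    (length-filter P? (Graph.vertex G))

  sum-𝟙-row : ∀ {n} (i : Fin n) → sum (λ j → 𝟙 i j) ≡ 1
  sum-𝟙-row i = trans (sum-cong λ j → sym (ℕ.*-identityʳ (𝟙 i j))) (sum-𝟙 i (λ _ → 1))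

  -- The degree in `K n`, with `suc` on the left to avoid truncated subtraction: `𝟙 i` and its
  -- complement add up to the constant 1.
  count-others : ∀ {n} (i : Fin n) → suc (sum (λ j → ⟦ not (does (i Fin.≟ j)) ⟧)) ≡ n
  count-others {n} i = begin
    1 + sum (λ j → ⟦ not (does (i Fin.≟ j)) ⟧)       ≡⟨ cong (_+ sum (λ j → ⟦ not (does (i Fin.≟ j)) ⟧)) (sum-𝟙-row i) ⟨
    sum (𝟙 i) + sum (λ j → ⟦ not (does (i Fin.≟ j)) ⟧) ≡⟨ ∑-distrib-+ (𝟙 i) (λ j → ⟦ not (does (i Fin.≟ j)) ⟧) ⟨
    sum (λ j → 𝟙 i j + ⟦ not (does (i Fin.≟ j)) ⟧)   ≡⟨ sum-cong (λ j → either (does (i Fin.≟ j))) ⟩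
    sum {n} (λ _ → 1)                                 ≡⟨ ones n ⟩
    n ∎
    where
    either : ∀ b → ⟦ b ⟧ + ⟦ not b ⟧ ≡ 1
    either true = refl
    either false = refl
    ones : ∀ n → sum {n} (λ _ → 1) ≡ n
    ones zero = refl
    ones (suc n) = cong suc (ones n)

  adj : S.Vertex → S.Vertex → ℕ
  adj x y = ⟦ does (x S.∼? y) ⟧

  Shrikhande-regular : ∀ x → sum (λ k → adj x (S.vertex k)) ≡ 6
  Shrikhande-regular (a , b) = check a b
    where
    check : ∀ a b → sum (λ k → adj (a , b) (S.vertex k)) ≡ 6
    check = from-yes (Fin.all? λ a → Fin.all? λ b → sum (λ k → adj (a , b) (S.vertex k)) ℕ.≟ 6)

  -- In the parameters (16, 6, 2, 2) the two counts of common neighbours agree, so adjacent and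
  -- nonadjacent pairs are treated alike.
  Shrikhande-common : ∀ x y → x ≢ y → sum (λ k → adj x (S.vertex k) * adj y (S.vertex k)) ≡ 2
  Shrikhande-common (a , b) (c , d) = check a b c d
    where
    check : ∀ a b c d → (a , b) ≢ (c , d) → sum (λ k → adj (a , b) (S.vertex k) * adj (c , d) (S.vertex k)) ≡ 2
    check = from-yes (Fin.all? λ a → Fin.all? λ b → Fin.all? λ c → Fin.all? λ d → ¬? ((a , b) S.≟ (c , d)) →-dec
      (sum (λ k → adj (a , b) (S.vertex k) * adj (c , d) (S.vertex k)) ℕ.≟ 2))

  regular : ∀ t x → length (G.neighbours t x) ≡ t + 5
  regular t (x , i) = begin
    length (G.neighbours t (x , i))
      ≡⟨ length-filter-vertices (Γ t) (G._∼?_ t (x , i)) ⟩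
    sum (λ k → ⟦ does (G._∼?_ t (x , i) (G.vertex t k)) ⟧)
      ≡⟨ sum-□K Shrikhande t (λ y → ⟦ does (G._∼?_ t (x , i) y) ⟧) ⟩
    sum (λ y → sum (λ j → ⟦ does (G._∼?_ t (x , i) (S.vertex y , j)) ⟧))
      ≡⟨ sum-cong (λ y → row (S.vertex y)) ⟩
    sum (λ y → id# x (S.vertex y) * others + adj x (S.vertex y))
      ≡⟨ ∑-distrib-+ (λ y → id# x (S.vertex y) * others) (λ y → adj x (S.vertex y)) ⟩
    sum (λ y → id# x (S.vertex y) * others) + sum (λ y → adj x (S.vertex y))
      ≡⟨ cong₂ _+_ (sum-id# x (λ _ → others)) (Shrikhande-regular x) ⟩
    others + 6
      ≡⟨ ℕ.+-suc others 5 ⟩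
    suc others + 5
      ≡⟨ cong (_+ 5) (count-others i) ⟩
    t + 5 ∎
    where
    others = sum (λ j → ⟦ not (does (i Fin.≟ j)) ⟧)
    -- The two kinds of adjacency in the product exclude each other, one needing different copies
    -- and the other equal ones, so the disjunction becomes a sum.
    split : ∀ p q r → ⟦ (p ∧ not q) ∨ (q ∧ r) ⟧ ≡ ⟦ p ⟧ * ⟦ not q ⟧ + ⟦ q ⟧ * ⟦ r ⟧
    split true  true  true  = refl
    split true  true  false = refl
    split true  false r     = refl
    split false true  true  = refl
    split false true  false = refl
    split false false r     = refl
    row : ∀ y → sum (λ j → ⟦ does (G._∼?_ t (x , i) (y , j)) ⟧) ≡ id# x y * others + adj x y
    row y = begin
      sum (λ j → ⟦ does (G._∼?_ t (x , i) (y , j)) ⟧)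
        ≡⟨ sum-cong (λ j → split (does (x S.≟ y)) (does (i Fin.≟ j)) (does (x S.∼? y))) ⟩
      sum (λ j → id# x y * ⟦ not (does (i Fin.≟ j)) ⟧ + 𝟙 i j * adj x y)
        ≡⟨ ∑-distrib-+ (λ j → id# x y * ⟦ not (does (i Fin.≟ j)) ⟧) (λ j → 𝟙 i j * adj x y) ⟩
      sum (λ j → id# x y * ⟦ not (does (i Fin.≟ j)) ⟧) + sum (λ j → 𝟙 i j * adj x y)
        ≡⟨ cong₂ _+_ (sym (*-distribˡ-sum (id# x y) (λ j → ⟦ not (does (i Fin.≟ j)) ⟧))) (sum-𝟙 i (λ _ → adj x y)) ⟩
      id# x y * others + adj x y ∎

  sum≢0⇒∃≢0 : ∀ {n} (f : Fin n → ℕ) → sum f ≢ 0 → ∃[ i ] f i ≢ 0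
  sum≢0⇒∃≢0 {zero}  f ≢0 = contradiction refl ≢0
  sum≢0⇒∃≢0 {suc n} f ≢0 with f 0F in eq
  ... | suc _ = 0F , λ f0≡0 → contradiction (trans (sym f0≡0) eq) λ ()
  ... | zero  = let i , fi≢0 = sum≢0⇒∃≢0 (f ∘ suc) ≢0 in suc i , fi≢0

  both : ∀ {P Q : Set} (p? : Dec P) (q? : Dec Q) → ⟦ does p? ⟧ * ⟦ does q? ⟧ ≢ 0 → P × Q
  both (yes p) (yes q) _  = p , q
  both (yes p) (no _)  ≢0 = contradiction refl ≢0
  both (no _)  _       ≢0 = contradiction refl ≢0

  abstract
    -- A nonzero count has a nonzero term. Hence any two vertices are joined by a walk of length at
    -- most 2; `abstract` keeps the witness from being unfolded.
    Shrikhande-common-neighbour : ∀ x y → x ≢ y → ∃[ z ] x S.∼ z × y S.∼ z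
    Shrikhande-common-neighbour x y x≢y =
      let k , ≢0 = sum≢0⇒∃≢0 (λ k → adj x (S.vertex k) * adj y (S.vertex k))
                     (λ eq → contradiction (trans (sym eq) (Shrikhande-common x y x≢y)) λ ())
      in S.vertex k , both (x S.∼? S.vertex k) (y S.∼? S.vertex k) ≢0

  Shrikhande-walk : ∀ x y → S.Walk x y
  Shrikhande-walk x y = from-dec (x S.≟ y)
    where
    from-dec : Dec (x ≡ y) → S.Walk x y
    from-dec (yes refl) = ε
    from-dec (no x≢y) =
      let z , x∼z , y∼z = Shrikhande-common-neighbour x y x≢y
      in _◅_ {j = z} {k = y} x∼z (_◅_ {j = y} {k = y} (S.∼-sym {y} {z} y∼z) ε)

  -- Excludes from the truth tables `pointwise` the rows in which one vertex equals two distinct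
  -- ones.
  disjoint : ∀ (G : Graph) {x y : Graph.Vertex G} → x ≢ y → ∀ z → does (Graph._≟_ G x z) ∧ does (Graph._≟_ G y z) ≡ false
  disjoint G {x} {y} x≢y z = dec-false (Graph._≟_ G x z ×-dec Graph._≟_ G y z) λ (x≡z , y≡z) → x≢y (trans x≡z (sym y≡z))

  module _ (t : ℕ) where
    open Graph (Γ t) using (_∼_; _∼?_; Walk; Dist; commonNeighbours)

    count-common : ∀ x i y j → length (commonNeighbours (x , i) (y , j))
      ≡ sum (λ z → sum (λ k → ⟦ does ((x , i) ∼? (S.vertex z , k)) ∧ does ((y , j) ∼? (S.vertex z , k)) ⟧))
    count-common x i y j = trans
      (length-filter-vertices (Γ t) (λ z → ((x , i) ∼? z) ×-dec ((y , j) ∼? z)))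
      (sum-□K Shrikhande t (λ z → ⟦ does ((x , i) ∼? z) ∧ does ((y , j) ∼? z) ⟧))

    -- A common neighbour in another copy would lie over both x and y, so all common neighbours are
    -- in copy i and the count is that of the Shrikhande graph.
    common-same-copy : ∀ {x y} i → x ≢ y → length (commonNeighbours (x , i) (y , i)) ≡ 2
    common-same-copy {x} {y} i x≢y = begin
      length (commonNeighbours (x , i) (y , i))
        ≡⟨ count-common x i y i ⟩
      sum (λ z → sum (λ k → ⟦ does ((x , i) ∼? (S.vertex z , k)) ∧ does ((y , i) ∼? (S.vertex z , k)) ⟧))
        ≡⟨ sum-cong (λ z → trans
             (sum-cong λ k → pointwise (does (x S.≟ S.vertex z)) (does (y S.≟ S.vertex z)) (does (i Fin.≟ k))
                (does (x S.∼? S.vertex z)) (does (y S.∼? S.vertex z)) (disjoint Shrikhande x≢y (S.vertex z)))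
             (sum-𝟙 i (λ _ → adj x (S.vertex z) * adj y (S.vertex z)))) ⟩
      sum (λ z → adj x (S.vertex z) * adj y (S.vertex z))
        ≡⟨ Shrikhande-common x y x≢y ⟩
      2 ∎
      where
      pointwise : ∀ p p′ q r r′ → p ∧ p′ ≡ false →
        ⟦ ((p ∧ not q) ∨ (q ∧ r)) ∧ ((p′ ∧ not q) ∨ (q ∧ r′)) ⟧ ≡ ⟦ q ⟧ * (⟦ r ⟧ * ⟦ r′ ⟧)
      pointwise true  false true  true  true  _ = refl
      pointwise true  false true  true  false _ = refl
      pointwise true  false true  false r′    _ = refl
      pointwise true  false false r     r′    _ = refl
      pointwise false true  true  true  true  _ = refl
      pointwise false true  true  true  false _ = refl
      pointwise false true  true  false r′    _ = refl
      pointwise false true  false r     r′    _ = refl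
      pointwise false false true  true  true  _ = refl
      pointwise false false true  true  false _ = refl
      pointwise false false true  false r′    _ = refl
      pointwise false false false r     r′    _ = refl

    -- The two common neighbours are (x , j) and (y , i).
    common-two-copies : ∀ {x y i j} → x S.∼ y → i ≢ j → length (commonNeighbours (x , i) (y , j)) ≡ 2
    common-two-copies {x} {y} {i} {j} x∼y i≢j = begin
      length (commonNeighbours (x , i) (y , j))
        ≡⟨ count-common x i y j ⟩
      sum (λ z → sum (λ k → ⟦ does ((x , i) ∼? (S.vertex z , k)) ∧ does ((y , j) ∼? (S.vertex z , k)) ⟧))
        ≡⟨ sum-cong (λ z → trans
             (sum-cong λ k → pointwise (does (x S.≟ S.vertex z)) (does (y S.≟ S.vertex z)) (does (i Fin.≟ k)) (does (j Fin.≟ k))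
                (does (x S.∼? S.vertex z)) (does (y S.∼? S.vertex z))
                (disjoint Shrikhande x≢y (S.vertex z)) (disjoint (K t) i≢j k))
             (trans (∑-distrib-+ (λ k → 𝟙 j k * (id# x (S.vertex z) * adj y (S.vertex z)))
                                 (λ k → 𝟙 i k * (id# y (S.vertex z) * adj x (S.vertex z))))
                    (cong₂ _+_ (sum-𝟙 j (λ _ → id# x (S.vertex z) * adj y (S.vertex z)))
                               (sum-𝟙 i (λ _ → id# y (S.vertex z) * adj x (S.vertex z)))))) ⟩
      sum (λ z → id# x (S.vertex z) * adj y (S.vertex z) + id# y (S.vertex z) * adj x (S.vertex z))
        ≡⟨ ∑-distrib-+ (λ z → id# x (S.vertex z) * adj y (S.vertex z)) (λ z → id# y (S.vertex z) * adj x (S.vertex z)) ⟩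
      sum (λ z → id# x (S.vertex z) * adj y (S.vertex z)) + sum (λ z → id# y (S.vertex z) * adj x (S.vertex z))
        ≡⟨ cong₂ _+_ (sum-id# x (adj y)) (sum-id# y (adj x)) ⟩
      adj y x + adj x y
        ≡⟨ cong₂ (λ b b′ → ⟦ b ⟧ + ⟦ b′ ⟧) (dec-true (y S.∼? x) (S.∼-sym {x} {y} x∼y)) (dec-true (x S.∼? y) x∼y) ⟩
      2 ∎
      where
      x≢y : x ≢ y
      x≢y refl = S.∼-irrefl x x∼y
      pointwise : ∀ p p′ q q′ r r′ → p ∧ p′ ≡ false → q ∧ q′ ≡ false →
        ⟦ ((p ∧ not q) ∨ (q ∧ r)) ∧ ((p′ ∧ not q′) ∨ (q′ ∧ r′)) ⟧ ≡ ⟦ q′ ⟧ * (⟦ p ⟧ * ⟦ r′ ⟧) + ⟦ q ⟧ * (⟦ p′ ⟧ * ⟦ r ⟧)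
      pointwise true  false true  false true  r′    _ _ = refl
      pointwise true  false true  false false r′    _ _ = refl
      pointwise true  false false true  r     true  _ _ = refl
      pointwise true  false false true  r     false _ _ = refl
      pointwise true  false false false r     r′    _ _ = refl
      pointwise false true  true  false true  r′    _ _ = refl
      pointwise false true  true  false false r′    _ _ = refl
      pointwise false true  false true  r     r′    _ _ = refl
      pointwise false true  false false r     r′    _ _ = refl
      pointwise false false true  false true  r′    _ _ = refl
      pointwise false false true  false false r′    _ _ = refl
      pointwise false false false true  r     r′    _ _ = refl
      pointwise false false false false r     r′    _ _ = refl

    -- The walk of length 2 selects the count: mixed steps end in different copies over adjacent
    -- vertices, two Shrikhande steps end in the same copy over distinct vertices.
    sesqui : ∀ x y → Dist x y 2 → length (commonNeighbours x y) ≡ 2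
    sesqui (x , i) (y , j) ((e ◅ f ◅ ε , refl) , far) = case e f
      where
      distinct : (x , i) ≢ (y , j)
      distinct refl = contradiction (far ε) λ ()
      nonadjacent : ¬ ((x , i) ∼ (y , j))
      nonadjacent e = contradiction (far (e ◅ ε)) λ { (s≤s ()) }
      case : ∀ {z} → (x , i) ∼ z → z ∼ (y , j) → length (commonNeighbours (x , i) (y , j)) ≡ 2
      -- Two steps in `K t` join vertices that are equal or adjacent, and minimality of the distance
      -- rules out both.
      case (inj₁ (refl , i≢k)) (inj₁ (refl , k≢j)) = contradiction (inj₁ (refl , λ { refl → distinct refl })) nonadjacent
      case (inj₁ (refl , i≢k)) (inj₂ (refl , x∼y)) = common-two-copies x∼y i≢k
      case (inj₂ (refl , x∼y)) (inj₁ (refl , i≢j)) = common-two-copies x∼y i≢j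
      case (inj₂ (refl , x∼z)) (inj₂ (refl , z∼y)) = common-same-copy i λ { refl → distinct refl }

    -- A walk first changes the copy and then stays in it; `i₀` supplies the vertex that `Connected`
    -- demands.
    Γ-connected : Fin t → Connected (Γ t)
    Γ-connected i₀ = ((0F , 0F) , i₀) , λ (x , i) (y , j) → along x i j ◅◅ gmap (_, j) (λ e → inj₂ (refl , e)) (Shrikhande-walk x y)
      where
      along : ∀ x i j → Walk (x , i) (x , j)
      along x i j with i Fin.≟ j
      ... | yes refl = ε
      ... | no i≢j = inj₁ (refl , i≢j) ◅ ε

    Γ-sesquiRegular : SesquiRegular (Γ t) (16 * t) (t + 5) 2
    Γ-sesquiRegular = record { order≡n = refl ; regular = regular t ; sesqui = sesqui }

-- Integral Gram factorisations

module Lattice where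
  open import Data.Integer.Base using (_+_; _*_; _-_; -_; +_; _≤_; +≤+)
  open FiniteSums ℤ.+-*-semiring
  open ≡-Reasoning

  -- Modulo 2 these relations say that x is a word of the [7,4] Hamming code.
  record Hamming (x : Fin 7 → ℤ) : Set where
    constructor hamming
    field
      p q u : ℤ
      α₁ : x 2F ≡ + 2 * u - (x 1F + x 3F + x 4F)
      γ₀ : x 5F ≡ + 2 * p - (x 0F + x 1F + x 3F)
      γ₁ : x 6F ≡ + 2 * q - (x 0F + x 1F + x 4F)

  -- The parity of the weight of the word. Appending this bit gives the doubly even extended Hamming
  -- code; the lift to ℤ is chosen so that x · x + parity x ² is divisible by 4.
  parity : (Fin 7 → ℤ) → ℤ
  parity x = x 0F + x 3F + x 4F

  private
    -- The left side is a dot product as `sum` unfolds it, final zero included, with α₁, γ₀, γ₁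
    -- eliminated; the coefficient of 2 becomes the witness in `bilinear′`.
    bilinear : ∀ c α₀ β₀ β₁ p q u c′ α₀′ β₀′ β₁′ p′ q′ u′ →
      c * c′ + (α₀ * α₀′ + ((+ 2 * u - (α₀ + β₀ + β₁)) * (+ 2 * u′ - (α₀′ + β₀′ + β₁′)) +
        (β₀ * β₀′ + (β₁ * β₁′ + ((+ 2 * p - (c + α₀ + β₀)) * (+ 2 * p′ - (c′ + α₀′ + β₀′))
        + ((+ 2 * q - (c + α₀ + β₁)) * (+ 2 * q′ - (c′ + α₀′ + β₁′)) + + 0))))))
      ≡ (+ 2 * (c * c′ + α₀ * α₀′ + β₀ * β₀′ + β₁ * β₁′)
        + c * (α₀′ + β₀′ + β₁′) + α₀ * (c′ + β₀′ + β₁′) + β₀ * (c′ + α₀′ + β₁′) + β₁ * (c′ + α₀′ + β₀′)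
        + u * (u′ - (α₀′ + β₀′ + β₁′)) + (u - (α₀ + β₀ + β₁)) * u′
        + p * (p′ - (c′ + α₀′ + β₀′)) + (p - (c + α₀ + β₀)) * p′
        + q * (q′ - (c′ + α₀′ + β₁′)) + (q - (c + α₀ + β₁)) * q′) * + 2
        - (c + β₀ + β₁) * (c′ + β₀′ + β₁′)
    bilinear = solve-∀

    quadratic : ∀ c α₀ β₀ β₁ p q u →
      c * c + (α₀ * α₀ + ((+ 2 * u - (α₀ + β₀ + β₁)) * (+ 2 * u - (α₀ + β₀ + β₁)) +
        (β₀ * β₀ + (β₁ * β₁ + ((+ 2 * p - (c + α₀ + β₀)) * (+ 2 * p - (c + α₀ + β₀))
        + ((+ 2 * q - (c + α₀ + β₁)) * (+ 2 * q - (c + α₀ + β₁)) + + 0))))))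
      ≡ (c * c + α₀ * α₀ + β₀ * β₀ + β₁ * β₁ + c * (α₀ + β₀ + β₁) + α₀ * (β₀ + β₁) + β₀ * β₁
        + u * (u - (α₀ + β₀ + β₁)) + p * (p - (c + α₀ + β₀)) + q * (q - (c + α₀ + β₁))) * + 4
        - (c + β₀ + β₁) * (c + β₀ + β₁)
    quadratic = solve-∀

    -- Here the relations concern variables, so matching on `refl` eliminates α₁, γ₀, γ₁; for values
    -- such as `x 2F` this match would be impossible.
    bilinear′ : ∀ c α₀ β₀ β₁ p q u c′ α₀′ β₀′ β₁′ p′ q′ u′ {α₁ γ₀ γ₁ α₁′ γ₀′ γ₁′} →
      α₁ ≡ + 2 * u - (α₀ + β₀ + β₁) → γ₀ ≡ + 2 * p - (c + α₀ + β₀) → γ₁ ≡ + 2 * q - (c + α₀ + β₁) →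
      α₁′ ≡ + 2 * u′ - (α₀′ + β₀′ + β₁′) → γ₀′ ≡ + 2 * p′ - (c′ + α₀′ + β₀′) → γ₁′ ≡ + 2 * q′ - (c′ + α₀′ + β₁′) →
      ∃[ h ] c * c′ + (α₀ * α₀′ + (α₁ * α₁′ + (β₀ * β₀′ + (β₁ * β₁′ + (γ₀ * γ₀′ + (γ₁ * γ₁′ + + 0))))))
           ≡ h * + 2 - (c + β₀ + β₁) * (c′ + β₀′ + β₁′)
    bilinear′ c α₀ β₀ β₁ p q u c′ α₀′ β₀′ β₁′ p′ q′ u′ refl refl refl refl refl refl =
      (+ 2 * (c * c′ + α₀ * α₀′ + β₀ * β₀′ + β₁ * β₁′)
        + c * (α₀′ + β₀′ + β₁′) + α₀ * (c′ + β₀′ + β₁′) + β₀ * (c′ + α₀′ + β₁′) + β₁ * (c′ + α₀′ + β₀′)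
        + u * (u′ - (α₀′ + β₀′ + β₁′)) + (u - (α₀ + β₀ + β₁)) * u′
        + p * (p′ - (c′ + α₀′ + β₀′)) + (p - (c + α₀ + β₀)) * p′
        + q * (q′ - (c′ + α₀′ + β₁′)) + (q - (c + α₀ + β₁)) * q′)
      , bilinear c α₀ β₀ β₁ p q u c′ α₀′ β₀′ β₁′ p′ q′ u′

    quadratic′ : ∀ c α₀ β₀ β₁ p q u {α₁ γ₀ γ₁} →
      α₁ ≡ + 2 * u - (α₀ + β₀ + β₁) → γ₀ ≡ + 2 * p - (c + α₀ + β₀) → γ₁ ≡ + 2 * q - (c + α₀ + β₁) →
      ∃[ h ] c * c + (α₀ * α₀ + (α₁ * α₁ + (β₀ * β₀ + (β₁ * β₁ + (γ₀ * γ₀ + (γ₁ * γ₁ + + 0))))))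
           ≡ h * + 4 - (c + β₀ + β₁) * (c + β₀ + β₁)
    quadratic′ c α₀ β₀ β₁ p q u refl refl refl =
      (c * c + α₀ * α₀ + β₀ * β₀ + β₁ * β₁ + c * (α₀ + β₀ + β₁) + α₀ * (β₀ + β₁) + β₀ * β₁
        + u * (u - (α₀ + β₀ + β₁)) + p * (p - (c + α₀ + β₀)) + q * (q - (c + α₀ + β₁)))
      , quadratic c α₀ β₀ β₁ p q u

  abstract
    -- Self-orthogonality of the extended Hamming code: with the parities appended, dot products are
    -- even.
    hamming-bilinear : ∀ {x y} → Hamming x → Hamming y →
      ∃[ h ] sum (λ i → x i * y i) ≡ h * + 2 - parity x * parity y
    hamming-bilinear {x} {y} (hamming p q u e₁ e₂ e₃) (hamming p′ q′ u′ f₁ f₂ f₃) =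
      bilinear′ (x 0F) (x 1F) (x 3F) (x 4F) p q u (y 0F) (y 1F) (y 3F) (y 4F) p′ q′ u′ e₁ e₂ e₃ f₁ f₂ f₃

    hamming-quadratic : ∀ {x} → Hamming x →
      ∃[ h ] sum (λ i → x i * x i) ≡ h * + 4 - parity x * parity x
    hamming-quadratic {x} (hamming p q u e₁ e₂ e₃) =
      quadratic′ (x 0F) (x 1F) (x 3F) (x 4F) p q u e₁ e₂ e₃

  -- The matrix A + 2I has rank 7. These nine vertices suffice for writing the seven frame vectors
  -- and the halves `p`, `q`, `u` as integral combinations.
  point : Fin 9 → ℤ₄ × ℤ₄
  point = lookup ((0F , 0F) ∷ (0F , 1F) ∷ (0F , 2F) ∷ (1F , 0F) ∷ (1F , 1F) ∷ (1F , 2F) ∷ (2F , 0F) ∷ (2F , 1F) ∷ (3F , 2F) ∷ [])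

  rootGram : Fin 9 → Fin 9 → ℤ
  rootGram k l = + 2 * (S.adjacencyMatrix (point k) (point l) + + 2 * S.identityMatrix (point k) (point l))

  -- Coefficients with respect to nine vectors d with Gram matrix 2(A + 2I). On the full graph one has
  -- 2 d(a , b) = c + α(a) + β(b) + γ(a - b), where α, β and γ change sign under a shift by 2, and
  -- solving these equations expresses the seven vectors integrally; p, q are d(0 , 0), d(0 , 1), and
  -- u is the integral vector ½ (α₀ + α₁ + β₀ + β₁).
  c α₀ α₁ β₀ β₁ γ₀ γ₁ p q u : Vector ℤ 9
  c k  = 𝟙 1F k - 𝟙 4F k - 𝟙 2F k + 𝟙 5F k + 𝟙 3F k + 𝟙 8F k
  α₀ k = 𝟙 0F k + 𝟙 2F k - c k
  β₀ k = 𝟙 0F k + 𝟙 6F k - c k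
  β₁ k = 𝟙 1F k + 𝟙 7F k - c k
  p = 𝟙 0F
  q = 𝟙 1F
  u k = 𝟙 3F k + 𝟙 1F k - c k
  α₁ k = + 2 * u k - (α₀ k + β₀ k + β₁ k)
  γ₀ k = + 2 * p k - (c k + α₀ k + β₀ k)
  γ₁ k = + 2 * q k - (c k + α₀ k + β₁ k)

  frame : Fin 7 → Vector ℤ 9
  frame = lookup (c ∷ α₀ ∷ α₁ ∷ β₀ ∷ β₁ ∷ γ₀ ∷ γ₁ ∷ [])

  -- Up to the factor √2 the frame consists of seven pairwise orthogonal roots of E₇; evaluation of
  -- the Gram matrix confirms this.
  frame-orthogonal : ∀ i j → sum (λ k → frame i k * sum (λ l → frame j l * rootGram k l)) ≡ 𝟙 i j * + 4
  frame-orthogonal = from-yes (Fin.all? λ i → Fin.all? λ j → sum (λ k → frame i k * sum (λ l → frame j l * rootGram k l)) ℤ.≟ 𝟙 i j * + 4)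

  -- Integral vectors, positivity and divisibility.

  dot : ∀ {m} → (Fin m → ℤ) → (Fin m → ℤ) → ℤ
  dot v w = sum (λ j → v j * w j)

  dot-comm : ∀ {m} (v w : Fin m → ℤ) → dot v w ≡ dot w v
  dot-comm v w = sum-cong λ j → ℤ.*-comm (v j) (w j)

  dot-sumˡ : ∀ {m n} (a : Fin n → ℤ) (f : Fin n → Fin m → ℤ) (w : Fin m → ℤ) →
    dot (λ j → sum λ k → a k * f k j) w ≡ sum (λ k → a k * dot (f k) w)
  dot-sumˡ a f w = begin
    sum (λ j → sum (λ k → a k * f k j) * w j)
      ≡⟨ sum-cong (λ j → *-distribʳ-sum (w j) (λ k → a k * f k j)) ⟩
    sum (λ j → sum (λ k → a k * f k j * w j))
      ≡⟨ ∑-comm (λ j k → a k * f k j * w j) ⟩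
    sum (λ k → sum (λ j → a k * f k j * w j))
      ≡⟨ sum-cong (λ k → trans (sum-cong λ j → ℤ.*-assoc (a k) (f k j) (w j))
                                (sym (*-distribˡ-sum (a k) (λ j → f k j * w j)))) ⟩
    sum (λ k → a k * dot (f k) w) ∎

  -- Differences such as `row`, `w` and `comb` below are written as a f - b g, with coefficients
  -- `+ 1` where necessary, so that this rule and `dot-lin` apply to them directly.
  sum-lin : ∀ {m} a b (f g : Fin m → ℤ) → sum (λ j → a * f j - b * g j) ≡ a * sum f - b * sum g
  sum-lin {zero}  a b f g = sym (cong₂ _-_ (ℤ.*-zeroʳ a) (ℤ.*-zeroʳ b))
  sum-lin {suc m} a b f g = trans
    (cong (λ s → (a * f zero - b * g zero) + s) (sum-lin a b (λ j → f (suc j)) (λ j → g (suc j))))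
    (step a b (f zero) (g zero) _ _)
    where
    step : ∀ a b x y s t → (a * x - b * y) + (a * s - b * t) ≡ a * (x + s) - b * (y + t)
    step = solve-∀

  dot-lin : ∀ {m} a b (v v′ w : Fin m → ℤ) →
    dot (λ j → a * v j - b * v′ j) w ≡ a * dot v w - b * dot v′ w
  dot-lin a b v v′ w = trans (sum-cong λ j → step a b (v j) (v′ j) (w j))
                             (sum-lin a b (λ j → v j * w j) (λ j → v′ j * w j))
    where
    step : ∀ a b x y w → (a * x - b * y) * w ≡ a * (x * w) - b * (y * w)
    step = solve-∀

  sum-nonneg : ∀ {n} {f : Fin n → ℤ} → (∀ i → 0ℤ ≤ f i) → 0ℤ ≤ sum f
  sum-nonneg {zero}  f≥0 = ℤ.≤-refl
  sum-nonneg {suc n} f≥0 = ℤ.+-mono-≤ (f≥0 zero) (sum-nonneg λ i → f≥0 (suc i))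

  square-nonneg : ∀ x → 0ℤ ≤ x * x
  square-nonneg (+ zero)   = ℤ.≤-refl
  square-nonneg (+ suc n)  = +≤+ ℕ.z≤n
  square-nonneg -[1+ n ]   = +≤+ ℕ.z≤n

  dot-nonneg : ∀ {m} (v : Fin m → ℤ) → 0ℤ ≤ dot v v
  dot-nonneg v = sum-nonneg λ j → square-nonneg (v j)

  dot≡0⇒≡0 : ∀ {m} (v : Fin m → ℤ) → dot v v ≡ 0ℤ → ∀ j → v j ≡ 0ℤ
  dot≡0⇒≡0 {suc m} v vv≡0 = λ { zero → head≡0 ; (suc j) → dot≡0⇒≡0 (λ j → v (suc j)) tail≡0 j }
    where
    x² = v zero * v zero
    rest = dot (λ j → v (suc j)) (λ j → v (suc j))
    rest≥0 = dot-nonneg (λ j → v (suc j))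
    x²≡0 : x² ≡ 0ℤ
    x²≡0 = ℤ.≤-antisym (subst (x² ≤_) vv≡0 (subst (_≤ x² + rest) (ℤ.+-identityʳ x²) (ℤ.+-monoʳ-≤ x² rest≥0))) (square-nonneg (v zero))
    tail≡0 : rest ≡ 0ℤ
    tail≡0 = trans (sym (ℤ.+-identityˡ rest)) (trans (cong (_+ rest) (sym x²≡0)) vv≡0)
    head≡0 : v zero ≡ 0ℤ
    head≡0 = [ (λ p → p) , (λ p → p) ]′ (ℤ.i*j≡0⇒i≡0∨j≡0 (v zero) x²≡0)

  4x≡0⇒x≡0 : ∀ x → + 4 * x ≡ 0ℤ → x ≡ 0ℤ
  4x≡0⇒x≡0 x eq = ℤ.*-cancelˡ-≡ (+ 4) x 0ℤ eq

  ∣-sum : ∀ {n} {a} {f : Fin n → ℤ} → (∀ i → a ∣ f i) → a ∣ sum f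
  ∣-sum {zero}  {a} a∣f = divides 0ℤ refl
  ∣-sum {suc n} a∣f = ∣m∣n⇒∣m+n (a∣f zero) (∣-sum λ i → a∣f (suc i))

  even⊎odd : ∀ n → (∃[ h ] n ≡ h * + 2) ⊎ (∃[ h ] n ≡ + 1 + h * + 2)
  even⊎odd n = by-remainder (n ℤ.% + 2) (ℤ.n%d<d n (+ 2)) (ℤ.a≡a%n+[a/n]*n n (+ 2))
    where
    by-remainder : ∀ r → r ℕ.< 2 → n ≡ + r + n ℤ./ + 2 * + 2 → (∃[ h ] n ≡ h * + 2) ⊎ (∃[ h ] n ≡ + 1 + h * + 2)
    by-remainder 0 _ eq = inj₁ (n ℤ./ + 2 , trans eq (ℤ.+-identityˡ _))
    by-remainder 1 _ eq = inj₂ (n ℤ./ + 2 , eq)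
    by-remainder (suc (suc r)) (ℕ.s≤s (ℕ.s≤s ())) eq

  all-even⊎some-odd : ∀ {n} (f : Fin n → ℤ) → (∀ i → + 2 ∣ f i) ⊎ (∃[ i ] ∃[ h ] f i ≡ + 1 + h * + 2)
  all-even⊎some-odd {zero} f = inj₁ λ ()
  all-even⊎some-odd {suc n} f with even⊎odd (f zero) | all-even⊎some-odd (λ i → f (suc i))
  ... | inj₂ (h , eq) | _ = inj₂ (zero , h , eq)
  ... | inj₁ _        | inj₂ (i , h , eq) = inj₂ (suc i , h , eq)
  ... | inj₁ (h , eq) | inj₁ even = inj₁ λ { zero → divides h eq ; (suc i) → even i }

  square≤1 : ∀ e → e * e ≤ + 1 → e ≡ 0ℤ ⊎ e * e ≡ + 1
  square≤1 (+ 0)             _                = inj₁ refl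
  square≤1 (+ 1)             _                = inj₂ refl
  square≤1 (+ suc (suc n))   (+≤+ (ℕ.s≤s ()))
  square≤1 -[1+ 0 ]          _                = inj₂ refl
  square≤1 -[1+ suc n ]      (+≤+ (ℕ.s≤s ()))

  even≢odd : ∀ a b → a * + 2 ≢ + 1 + b * + 2
  even≢odd a b eq = from-no (+ 2 ∣? + 1) (divides (a - b) (trans (cancel (b * + 2)) (trans (cong (_- b * + 2) (sym eq)) (dist a b))))
    where
    cancel : ∀ y → + 1 ≡ + 1 + y - y
    cancel = solve-∀
    dist : ∀ a b → a * + 2 - b * + 2 ≡ (a - b) * + 2
    dist = solve-∀

  0≤4z≤4 : ∀ z → 0ℤ ≤ z * + 4 → z * + 4 ≤ + 4 → z ≡ 0ℤ ⊎ z ≡ + 1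
  0≤4z≤4 (+ 0) _ _ = inj₁ refl
  0≤4z≤4 (+ 1) _ _ = inj₂ refl
  0≤4z≤4 (+ suc (suc n)) _ (+≤+ (ℕ.s≤s (ℕ.s≤s (ℕ.s≤s (ℕ.s≤s ())))))
  0≤4z≤4 -[1+ n ] () _

  1≤4z≤5 : ∀ z → + 1 ≤ z * + 4 → z * + 4 ≤ + 5 → z ≡ + 1
  1≤4z≤5 (+ 0) (+≤+ ()) _
  1≤4z≤5 (+ 1) _ _ = refl
  1≤4z≤5 (+ suc (suc n)) _ (+≤+ (ℕ.s≤s (ℕ.s≤s (ℕ.s≤s (ℕ.s≤s (ℕ.s≤s ()))))))
  1≤4z≤5 -[1+ n ] () _

  -- The orthogonal frame and the projection onto its complement.

  module Frame {m} (d : Fin 9 → Fin m → ℤ) (gram : ∀ k l → dot (d k) (d l) ≡ rootGram k l) where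

    V : (Fin 9 → ℤ) → Fin m → ℤ
    V a j = sum λ k → a k * d k j

    O : Fin 7 → Fin m → ℤ
    O p = V (frame p)

    O-orthogonal : ∀ p q → dot (O p) (O q) ≡ 𝟙 p q * + 4
    O-orthogonal p q = begin
      dot (O p) (O q)
        ≡⟨ dot-sumˡ (frame p) d (O q) ⟩
      sum (λ k → frame p k * dot (d k) (O q))
        ≡⟨ sum-cong (λ k → cong (frame p k *_) (trans (dot-comm (d k) (O q)) (dot-sumˡ (frame q) d (d k)))) ⟩
      sum (λ k → frame p k * sum (λ l → frame q l * dot (d l) (d k)))
        ≡⟨ sum-cong (λ k → cong (frame p k *_) (sum-cong λ l → cong (frame q l *_) (trans (dot-comm (d l) (d k)) (gram k l)))) ⟩
      sum (λ k → frame p k * sum (λ l → frame q l * rootGram k l))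
        ≡⟨ frame-orthogonal p q ⟩
      𝟙 p q * + 4 ∎

    -- As the frame vectors are orthogonal of norm 4, N / 4 is the projection onto their span. At
    -- the same time N i j is the dot product of the words at the coordinates i and j.
    N : Fin m → Fin m → ℤ
    N i j = sum λ p → O p i * O p j

    Orth : (Fin m → ℤ) → Set
    Orth v = ∀ p → dot (O p) v ≡ 0ℤ

    -- row / 4 is the orthogonal projection onto the complement of the span of the frame.
    row : Fin m → Fin m → ℤ
    row i j = + 4 * 𝟙 i j - + 1 * N i j

    row-dot′ : ∀ i v → dot (row i) v ≡ + 4 * v i - + 1 * sum (λ p → O p i * dot (O p) v)
    row-dot′ i v = trans (dot-lin (+ 4) (+ 1) (𝟙 i) (N i) v)
      (cong₂ (λ x y → + 4 * x - + 1 * y) (sum-𝟙 i v) (dot-sumˡ (λ p → O p i) O v))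

    row-dot : ∀ {v} → Orth v → ∀ i → dot (row i) v ≡ + 4 * v i
    row-dot {v} v⊥O i = begin
      dot (row i) v                                        ≡⟨ row-dot′ i v ⟩
      + 4 * v i - + 1 * sum (λ p → O p i * dot (O p) v)
        ≡⟨ cong (λ x → + 4 * v i - + 1 * x)
             (trans (sum-cong λ p → trans (cong (O p i *_) (v⊥O p)) (ℤ.*-zeroʳ (O p i))) (sum-replicate-zero 7)) ⟩
      + 4 * v i - + 1 * 0ℤ                                 ≡⟨ ℤ.+-identityʳ _ ⟩
      + 4 * v i                                            ∎

    row-orth : ∀ i → Orth (row i)
    row-orth i p = begin
      dot (O p) (row i)  ≡⟨ dot-comm (O p) (row i) ⟩
      dot (row i) (O p)  ≡⟨ row-dot′ i (O p) ⟩
      + 4 * O p i - + 1 * sum (λ q → O q i * dot (O q) (O p))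
        ≡⟨ cong (λ x → + 4 * O p i - + 1 * x) (begin
             sum (λ q → O q i * dot (O q) (O p))
               ≡⟨ sum-cong (λ q → trans (cong (O q i *_) (trans (dot-comm (O q) (O p)) (O-orthogonal p q)))
                                    (swap (O q i) (𝟙 p q))) ⟩
             sum (λ q → 𝟙 p q * (+ 4 * O q i))
               ≡⟨ sum-𝟙 p (λ q → + 4 * O q i) ⟩
             + 4 * O p i ∎) ⟩
      + 4 * O p i - + 1 * (+ 4 * O p i)  ≡⟨ cancel (O p i) ⟩
      0ℤ ∎
      where
      swap : ∀ x y → x * (y * + 4) ≡ y * (+ 4 * x)
      swap = solve-∀
      cancel : ∀ x → + 4 * x - + 1 * (+ 4 * x) ≡ 0ℤ
      cancel = solve-∀

    -- Idempotence of the projection row / 4.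
    row-row : ∀ i j → dot (row i) (row j) ≡ + 4 * row j i
    row-row i j = row-dot (row-orth j) i

    V-comb : ∀ x a b c j → V (λ k → + 2 * x k - (a k + b k + c k)) j ≡ + 2 * V x j - (V a j + V b j + V c j)
    V-comb x a b c j = go x a b c (λ k → d k j)
      where
      step : ∀ w x a b c X A B C → (+ 2 * x - (a + b + c)) * w + (+ 2 * X - (A + B + C))
        ≡ + 2 * (x * w + X) - ((a * w + A) + (b * w + B) + (c * w + C))
      step = solve-∀
      go : ∀ {n} (x a b c w : Fin n → ℤ) → dot (λ k → + 2 * x k - (a k + b k + c k)) w
        ≡ + 2 * dot x w - (dot a w + dot b w + dot c w)
      go {zero}  x a b c w = refl
      go {suc n} x a b c w = trans
        (cong (λ s → (+ 2 * x zero - (a zero + b zero + c zero)) * w zero + s)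
          (go (λ k → x (suc k)) (λ k → a (suc k)) (λ k → b (suc k)) (λ k → c (suc k)) (λ k → w (suc k))))
        (step (w zero) (x zero) (a zero) (b zero) (c zero) _ _ _ _)

    -- The coefficients `α₁`, `γ₀`, `γ₁` satisfy the relations by definition, and `V` is linear;
    -- `p`, `q`, `u` become integers because they are integral combinations.
    O-hamming : ∀ j → Hamming (λ p → O p j)
    O-hamming j = hamming (V p j) (V q j) (V u j) (V-comb u α₀ β₀ β₁ j) (V-comb p c α₀ β₀ j) (V-comb q c α₀ β₁ j)

    ℓ : Fin m → ℤ
    ℓ j = parity (λ p → O p j)

    N-bilinear : ∀ i j → ∃[ h ] N i j ≡ h * + 2 - ℓ i * ℓ j
    N-bilinear i j = hamming-bilinear (O-hamming i) (O-hamming j)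

    N-quadratic : ∀ i → ∃[ h ] N i i ≡ h * + 4 - ℓ i * ℓ i
    N-quadratic i = hamming-quadratic (O-hamming i)

    V-𝟙 : ∀ k j → V (𝟙 k) j ≡ d k j
    V-𝟙 k j = sum-𝟙 k (λ k′ → d k′ j)

    V-u : ∀ j → V u j ≡ V (𝟙 3F) j + V (𝟙 1F) j - V c j
    V-u j = go (𝟙 3F) (𝟙 1F) c (λ k → d k j)
      where
      step : ∀ w a b c A B C → (a + b - c) * w + (A + B - C) ≡ (a * w + A) + (b * w + B) - (c * w + C)
      step = solve-∀
      go : ∀ {n} (a b c w : Fin n → ℤ) → dot (λ k → a k + b k - c k) w ≡ dot a w + dot b w - dot c w
      go {zero}  a b c w = refl
      go {suc n} a b c w = trans
        (cong (λ s → (a zero + b zero - c zero) * w zero + s)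
          (go (λ k → a (suc k)) (λ k → b (suc k)) (λ k → c (suc k)) (λ k → w (suc k))))
        (step (w zero) (a zero) (b zero) (c zero) _ _ _)

    double≡0 : ∀ {x y a b c} → x ≡ + 2 * y - (a + b + c) → x ≡ 0ℤ → a ≡ 0ℤ → b ≡ 0ℤ → c ≡ 0ℤ → y ≡ 0ℤ
    double≡0 {y = y} eq refl refl refl refl with ℤ.i*j≡0⇒i≡0∨j≡0 (+ 2) (trans (sym (ℤ.+-identityʳ (+ 2 * y))) (sym eq))
    ... | inj₂ y≡0 = y≡0

    -- The relations force the values of `p`, `q`, `u` at j to vanish; `d 0F` is given by `p` and
    -- `d 3F` by u - q + c. These are the two vectors at which the contradiction arises.
    O≡0⇒d≡0 : ∀ j → (∀ p → O p j ≡ 0ℤ) → d 0F j ≡ 0ℤ × d 3F j ≡ 0ℤ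
    O≡0⇒d≡0 j O≡0 = trans (sym (V-𝟙 0F j)) Vp≡0 , (begin
        d 3F j                             ≡⟨ V-𝟙 3F j ⟨
        V (𝟙 3F) j                         ≡⟨ isolate (V (𝟙 3F) j) (V q j) (V c j) ⟩
        (V (𝟙 3F) j + V q j - V c j) - V q j + V c j
          ≡⟨ cong₂ _+_ (cong₂ _-_ (trans (sym (V-u j)) Vu≡0) Vq≡0) (O≡0 0F) ⟩
        0ℤ ∎)
      where
      module H = Hamming (O-hamming j)
      isolate : ∀ x y z → x ≡ x + y - z - y + z
      isolate = solve-∀
      Vp≡0 = double≡0 H.γ₀ (O≡0 5F) (O≡0 0F) (O≡0 1F) (O≡0 3F)
      Vq≡0 = double≡0 H.γ₁ (O≡0 6F) (O≡0 0F) (O≡0 1F) (O≡0 4F)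
      Vu≡0 = double≡0 H.α₁ (O≡0 2F) (O≡0 1F) (O≡0 3F) (O≡0 4F)

    row-diag : ∀ i → row i i ≡ + 4 - N i i
    row-diag i = trans (cong (λ x → + 4 * x - + 1 * N i i) (𝟙-refl i)) (cong (λ x → + 4 - x) (ℤ.*-identityˡ (N i i)))

    N≥0 : ∀ i → 0ℤ ≤ N i i
    N≥0 i = dot-nonneg (λ p → O p i)

    -- By `row-row` the norm of `row i` is 4 (4 - N i i), and norms are nonnegative.
    N≤4 : ∀ i → N i i ≤ + 4
    N≤4 i = ℤ.0≤i-j⇒j≤i (ℤ.*-cancelˡ-≤-pos 0ℤ (+ 4 - N i i) (+ 4)
      (subst (0ℤ ≤_) (trans (row-row i i) (cong (+ 4 *_) (row-diag i))) (dot-nonneg (row i))))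

    -- The square of `ℓ i` is 1 modulo 4, so N i i + 1 is a multiple of 4 between 1 and 5. Thus N i
    -- i = 3: the word has weight 3.
    odd⇒row≡1 : ∀ i h → ℓ i ≡ + 1 + h * + 2 → row i i ≡ + 1
    odd⇒row≡1 i h ℓ≡ = trans (row-diag i) (trans (cong (λ x → + 4 - x) N≡) (cong (λ z → + 4 - (z * + 4 - + 1)) z≡1))
      where
      w = proj₁ (N-quadratic i)
      z = w - h * h - h
      arith : ∀ w h → w * + 4 - (+ 1 + h * + 2) * (+ 1 + h * + 2) ≡ (w - h * h - h) * + 4 - + 1
      arith = solve-∀
      N≡ : N i i ≡ z * + 4 - + 1
      N≡ = trans (proj₂ (N-quadratic i)) (trans (cong (λ x → w * + 4 - x * x) ℓ≡) (arith w h))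
      N+1≡ : N i i + + 1 ≡ z * + 4
      N+1≡ = trans (cong (_+ + 1) N≡) (back (z * + 4))
        where
        back : ∀ x → x - + 1 + + 1 ≡ x
        back = solve-∀
      z≡1 : z ≡ + 1
      z≡1 = 1≤4z≤5 z (subst (+ 1 ≤_) N+1≡ (ℤ.+-monoˡ-≤ (+ 1) (N≥0 i)))
                     (subst (_≤ + 5) N+1≡ (ℤ.+-monoˡ-≤ (+ 1) (N≤4 i)))

    -- Here N i i is a multiple of 4 between 0 and 4: the word is zero or has norm 4.
    even⇒N : ∀ i h → ℓ i ≡ h * + 2 → N i i ≡ 0ℤ ⊎ N i i ≡ + 4
    even⇒N i h ℓ≡ = Sum.map (λ z≡0 → trans N≡ (cong (_* + 4) z≡0)) (λ z≡1 → trans N≡ (cong (_* + 4) z≡1))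
      (0≤4z≤4 z (subst (0ℤ ≤_) N≡ (N≥0 i)) (subst (_≤ + 4) N≡ (N≤4 i)))
      where
      w = proj₁ (N-quadratic i)
      z = w - h * h
      arith : ∀ w h → w * + 4 - (h * + 2) * (h * + 2) ≡ (w - h * h) * + 4
      arith = solve-∀
      N≡ : N i i ≡ z * + 4
      N≡ = trans (proj₂ (N-quadratic i)) (trans (cong (λ x → w * + 4 - x * x) ℓ≡) (arith w h))

    -- A row of norm 0 vanishes, so the i-th unit vector lies in the rational span of the frame, and
    -- vectors orthogonal to the frame have no i-th coordinate.
    row≡0⇒ : ∀ i → row i i ≡ 0ℤ → ∀ {v} → Orth v → v i ≡ 0ℤ
    row≡0⇒ i row≡0 {v} v⊥O = 4x≡0⇒x≡0 (v i) (begin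
        + 4 * v i               ≡⟨ row-dot v⊥O i ⟨
        dot (row i) v           ≡⟨ sum-cong (λ j → cong (_* v j) (dot≡0⇒≡0 (row i) (trans (row-row i i) (cong (+ 4 *_) row≡0)) j)) ⟩
        sum {m} (λ _ → 0ℤ)      ≡⟨ sum-replicate-zero m ⟩
        0ℤ                      ∎)

    row-parity : ∀ i j → ∃[ h ] row i j ≡ h * + 2 + ℓ i * ℓ j
    row-parity i j = + 2 * 𝟙 i j - h , trans (cong (λ x → + 4 * 𝟙 i j - + 1 * x) eq) (arith (𝟙 i j) h (ℓ i * ℓ j))
      where
      h = proj₁ (N-bilinear i j)
      eq = proj₂ (N-bilinear i j)
      arith : ∀ x h y → + 4 * x - + 1 * (h * + 2 - y) ≡ (+ 2 * x - h) * + 2 + y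
      arith = solve-∀

    ⊥d⇒⊥O : ∀ {v} → (∀ k → dot (d k) v ≡ 0ℤ) → Orth v
    ⊥d⇒⊥O {v} v⊥d p = trans (dot-sumˡ (frame p) d v)
      (trans (sum-cong λ k → trans (cong (frame p k *_) (v⊥d k)) (ℤ.*-zeroʳ (frame p k))) (sum-replicate-zero 9))

    -- With e = `row i j`, the vector row j - e row i has norm 4 (1 - e²). As e is odd by
    -- `row-parity`, e² = 1 and the vector vanishes, so the two rows are proportional; pairing with
    -- v carries this over to coordinates.
    odd⇒aligned : ∀ i j h h′ → ℓ i ≡ + 1 + h * + 2 → ℓ j ≡ + 1 + h′ * + 2 →
      row i j * row i j ≡ + 1 × (∀ {v} → Orth v → v j ≡ row i j * v i)
    odd⇒aligned i j h h′ ℓi ℓj = e²≡1 , aligned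
      where
      e = row i j
      w : Fin m → ℤ
      w k = + 1 * row j k - e * row i k
      dot-w : ∀ {v} → Orth v → dot w v ≡ + 4 * (v j - e * v i)
      dot-w {v} v⊥O = trans (dot-lin (+ 1) e (row j) (row i) v)
        (trans (cong₂ (λ x y → + 1 * x - e * y) (row-dot v⊥O j) (row-dot v⊥O i)) (arith e (v i) (v j)))
        where
        arith : ∀ e x y → + 1 * (+ 4 * y) - e * (+ 4 * x) ≡ + 4 * (y - e * x)
        arith = solve-∀
      row-sym : row j i ≡ e
      row-sym = ℤ.*-cancelˡ-≡ (+ 4) (row j i) e (trans (sym (row-row i j)) (trans (dot-comm (row i) (row j)) (row-row j i)))
      w⊥O : Orth w
      w⊥O p = trans (dot-comm (O p) w) (trans (dot-lin (+ 1) e (row j) (row i) (O p))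
        (trans (cong₂ (λ x y → + 1 * x - e * y)
                 (trans (dot-comm (row j) (O p)) (row-orth j p))
                 (trans (dot-comm (row i) (O p)) (row-orth i p)))
               (arith e)))
        where
        arith : ∀ e → + 1 * 0ℤ - e * 0ℤ ≡ 0ℤ
        arith = solve-∀
      ww : dot w w ≡ + 4 * (+ 1 - e * e)
      ww = trans (dot-w w⊥O) (trans
        (cong₂ (λ x y → + 4 * ((+ 1 * x - e * e) - e * y))
          (odd⇒row≡1 j h′ ℓj)
          (cong₂ (λ x y → + 1 * x - e * y) row-sym (odd⇒row≡1 i h ℓi)))
        (arith e))
        where
        arith : ∀ e → + 4 * ((+ 1 * + 1 - e * e) - e * (+ 1 * e - e * + 1)) ≡ + 4 * (+ 1 - e * e)
        arith = solve-∀
      e-odd : ∃[ k ] e ≡ + 1 + k * + 2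
      e-odd = k + h + h′ + + 2 * (h * h′) ,
        trans (proj₂ (row-parity i j)) (trans (cong₂ (λ x y → k * + 2 + x * y) ℓi ℓj) (arith k h h′))
        where
        k = proj₁ (row-parity i j)
        arith : ∀ k h h′ → k * + 2 + (+ 1 + h * + 2) * (+ 1 + h′ * + 2) ≡ + 1 + (k + h + h′ + + 2 * (h * h′)) * + 2
        arith = solve-∀
      e²≡1 : e * e ≡ + 1
      e²≡1 = [ (λ e≡0 → contradiction (trans (sym e≡0) (proj₂ e-odd)) (even≢odd 0ℤ (proj₁ e-odd))) , (λ p → p) ]′
        (square≤1 e (ℤ.0≤i-j⇒j≤i (ℤ.*-cancelˡ-≤-pos 0ℤ (+ 1 - e * e) (+ 4) (subst (0ℤ ≤_) ww (dot-nonneg w)))))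
      aligned : ∀ {v} → Orth v → v j ≡ row i j * v i
      aligned {v} v⊥O = ℤ.i-j≡0⇒i≡j (v j) (e * v i) (4x≡0⇒x≡0 (v j - e * v i) (begin
          + 4 * (v j - e * v i)  ≡⟨ dot-w v⊥O ⟨
          dot w v                ≡⟨ sum-cong (λ k → cong (_* v k) (dot≡0⇒≡0 w (trans ww (cong (λ x → + 4 * (+ 1 - x)) e²≡1)) k)) ⟩
          sum {m} (λ _ → 0ℤ)     ≡⟨ sum-replicate-zero m ⟩
          0ℤ                     ∎))

    -- Meant for `s` and `s′` the sums of the columns of the two copies over the points `0F` and
    -- `3F`; the columns `b`, `b′` of the second copy witness the congruences modulo 2.
    module Glue {s s′ b b′ : Fin m → ℤ}
      (s⊥d : ∀ k → dot (d k) s ≡ 0ℤ) (s′⊥d : ∀ k → dot (d k) s′ ≡ 0ℤ)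
      (s≡ : ∀ j → s j ≡ b j * + 2 + d 0F j) (s′≡ : ∀ j → s′ j ≡ b′ j * + 2 + d 3F j) where

      s⊥O : Orth s
      s⊥O = ⊥d⇒⊥O s⊥d

      s′⊥O : Orth s′
      s′⊥O = ⊥d⇒⊥O s′⊥d

      -- At a zero word `d 0F` and `d 3F` vanish, so both factors are even.
      N≡0⇒4∣ : ∀ j → N j j ≡ 0ℤ → + 4 ∣ s j * s′ j
      N≡0⇒4∣ j N≡0 = divides (b j * b′ j) (begin
          s j * s′ j                                     ≡⟨ cong₂ _*_ (s≡ j) (s′≡ j) ⟩
          (b j * + 2 + d 0F j) * (b′ j * + 2 + d 3F j)   ≡⟨ cong₂ (λ x y → (b j * + 2 + x) * (b′ j * + 2 + y)) (proj₁ ds≡0) (proj₂ ds≡0) ⟩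
          (b j * + 2 + 0ℤ) * (b′ j * + 2 + 0ℤ)           ≡⟨ arith (b j) (b′ j) ⟩
          b j * b′ j * + 4                               ∎)
        where
        ds≡0 = O≡0⇒d≡0 j (dot≡0⇒≡0 (λ p → O p j) N≡0)
        arith : ∀ x y → (x * + 2 + 0ℤ) * (y * + 2 + 0ℤ) ≡ x * y * + 4
        arith = solve-∀

      N≡4⇒4∣ : ∀ j → N j j ≡ + 4 → + 4 ∣ s j * s′ j
      N≡4⇒4∣ j N≡4 = subst (λ x → + 4 ∣ x * s′ j)
        (sym (row≡0⇒ j (trans (row-diag j) (cong (λ x → + 4 - x) N≡4)) s⊥O)) (divides 0ℤ refl)

      even⇒4∣ : ∀ j h → ℓ j ≡ h * + 2 → + 4 ∣ s j * s′ j
      even⇒4∣ j h ℓ≡ = [ N≡0⇒4∣ j , N≡4⇒4∣ j ]′ (even⇒N j h ℓ≡)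

      all-even⇒4∣dot : (∀ j → + 2 ∣ ℓ j) → + 4 ∣ dot s s′
      all-even⇒4∣dot even = ∣-sum λ j → even⇒4∣ j (quotient (even j)) (equality (even j))
        where open _∣_

      -- The products s j * s′ j are compared with X times the squared entries of `row i`, whose
      -- total is 4 X. The difference is zero at odd j by alignment; at even j both terms are
      -- divisible by 4.
      some-odd⇒4∣dot : ∀ i h → ℓ i ≡ + 1 + h * + 2 → + 4 ∣ dot s s′
      some-odd⇒4∣dot i h ℓi = subst (+ 4 ∣_) split (∣m∣n⇒∣m+n (∣-sum deviation) (∣m⇒∣m*n X (divides (+ 1) row²≡4)))
        where
        X = s i * s′ i
        row²≡4 : dot (row i) (row i) ≡ + 4
        row²≡4 = trans (row-row i i) (cong (+ 4 *_) (odd⇒row≡1 i h ℓi))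
        f : Fin m → ℤ
        f j = + 1 * (s j * s′ j) - X * (row i j * row i j)
        split : sum f + dot (row i) (row i) * X ≡ dot s s′
        split = trans (cong (_+ dot (row i) (row i) * X) (sum-lin (+ 1) X (λ j → s j * s′ j) (λ j → row i j * row i j)))
                      (arith (dot s s′) X (dot (row i) (row i)))
          where
          arith : ∀ d x r → + 1 * d - x * r + r * x ≡ d
          arith = solve-∀
        even-deviation : ∀ j h′ → ℓ j ≡ h′ * + 2 → + 4 ∣ f j
        even-deviation j h′ ℓ≡ = ∣m∣n⇒∣m-n (∣n⇒∣m*n (+ 1) (even⇒4∣ j h′ ℓ≡)) (∣n⇒∣m*n X (divides (y * y) row²))
          where
          k = proj₁ (row-parity i j)
          y = k + ℓ i * h′
          arith : ∀ k l h → (k * + 2 + l * (h * + 2)) * (k * + 2 + l * (h * + 2)) ≡ (k + l * h) * (k + l * h) * + 4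
          arith = solve-∀
          row² : row i j * row i j ≡ y * y * + 4
          row² = trans (cong (λ x → x * x) (trans (proj₂ (row-parity i j)) (cong (λ x → k * + 2 + ℓ i * x) ℓ≡))) (arith k (ℓ i) h′)
        odd-deviation : ∀ j h′ → ℓ j ≡ + 1 + h′ * + 2 → + 4 ∣ f j
        odd-deviation j h′ ℓ≡ = divides 0ℤ
          (trans (cong₂ (λ x y → + 1 * (x * y) - X * (row i j * row i j)) (al s⊥O) (al s′⊥O)) (arith (row i j) (s i) (s′ i)))
          where
          al : ∀ {v} → Orth v → v j ≡ row i j * v i
          al = proj₂ (odd⇒aligned i j h h′ ℓi ℓ≡)
          arith : ∀ e x y → + 1 * ((e * x) * (e * y)) - (x * y) * (e * e) ≡ 0ℤ
          arith = solve-∀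
        deviation : ∀ j → + 4 ∣ f j
        deviation j = [ (λ (h′ , ℓ≡) → even-deviation j h′ ℓ≡) , (λ (h′ , ℓ≡) → odd-deviation j h′ ℓ≡) ]′ (even⊎odd (ℓ j))

      -- At words of odd weight s and s′ are multiples of one row of norm 4; elsewhere s * s′ is divisible by 4.
      4∣dot : + 4 ∣ dot s s′
      4∣dot = [ all-even⇒4∣dot , (λ (i , h , ℓ≡) → some-odd⇒4∣dot i h ℓ≡) ]′ (all-even⊎some-odd ℓ)

  -- The columns over two copies of the Shrikhande graph.

  module _ {t m} (N : Fin m → Graph.Vertex (Γ (suc (suc t))) → ℤ)
    (gramΓ : ∀ x y → dot (λ j → N j x) (λ j → N j y)
                   ≡ G.adjacencyMatrix (suc (suc t)) x y + + 3 * G.identityMatrix (suc (suc t)) x y) where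

    private
      a b : Fin 9 → Fin m → ℤ
      a k j = N j (point k , 0F)
      b k j = N j (point k , 1F)

      A I : Fin 9 → Fin 9 → ℤ
      A k l = S.adjacencyMatrix (point k) (point l)
      I k l = S.identityMatrix (point k) (point l)

      copy : ∀ k l i → dot (λ j → N j (point k , i)) (λ j → N j (point l , i)) ≡ A k l + + 3 * I k l
      copy k l i = trans (gramΓ (point k , i) (point l , i))
        (cong₂ (λ x y → x + + 3 * y) (adjacency-copy (suc (suc t)) (point k) (point l) i) (identity-copy (suc (suc t)) (point k) (point l) i))

      copies : ∀ k l {i j} → i ≢ j → dot (λ q → N q (point k , i)) (λ q → N q (point l , j)) ≡ I k l
      copies k l {i} {j} i≢j = trans (gramΓ (point k , i) (point l , j))
        (trans (cong₂ (λ x y → x + + 3 * y) (adjacency-copies (suc (suc t)) (point k) (point l) i≢j)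
                                            (identity-≢ (Γ (suc (suc t))) (point k , i) (point l , j) (λ eq → i≢j (cong proj₂ eq))))
               (ℤ.+-identityʳ _))

      -- The parameter 1 gives the differences `d` and -1 the sums `s`, so that `dot-comb` computes
      -- all three Gram matrices at once.
      comb : ℤ → Fin 9 → Fin m → ℤ
      comb z k j = + 1 * a k j - z * b k j

      dot-comb : ∀ z z′ k l → dot (comb z k) (comb z′ l) ≡ (+ 1 + z * z′) * (A k l + + 3 * I k l) - (z + z′) * I k l
      dot-comb z z′ k l = begin
        dot (comb z k) (comb z′ l)
          ≡⟨ dot-lin (+ 1) z (a k) (b k) (comb z′ l) ⟩
        + 1 * dot (a k) (comb z′ l) - z * dot (b k) (comb z′ l)
          ≡⟨ cong₂ (λ x y → + 1 * x - z * y) (right (a k)) (right (b k)) ⟩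
        + 1 * (+ 1 * dot (a k) (a l) - z′ * dot (a k) (b l)) - z * (+ 1 * dot (b k) (a l) - z′ * dot (b k) (b l))
          ≡⟨ cong₂ (λ x y → + 1 * x - z * y)
               (cong₂ (λ x y → + 1 * x - z′ * y) (copy k l 0F) (copies k l λ ()))
               (cong₂ (λ x y → + 1 * x - z′ * y) (copies k l λ ()) (copy k l 1F)) ⟩
        + 1 * (+ 1 * (A k l + + 3 * I k l) - z′ * I k l) - z * (+ 1 * I k l - z′ * (A k l + + 3 * I k l))
          ≡⟨ arith z z′ (A k l + + 3 * I k l) (I k l) ⟩
        (+ 1 + z * z′) * (A k l + + 3 * I k l) - (z + z′) * I k l ∎
        where
        right : ∀ v → dot v (comb z′ l) ≡ + 1 * dot v (a l) - z′ * dot v (b l)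
        right v = trans (dot-comm v (comb z′ l)) (trans (dot-lin (+ 1) z′ (a l) (b l) v)
          (cong₂ (λ x y → + 1 * x - z′ * y) (dot-comm (a l) v) (dot-comm (b l) v)))
        arith : ∀ z z′ e i → + 1 * (+ 1 * e - z′ * i) - z * (+ 1 * i - z′ * e) ≡ (+ 1 + z * z′) * e - (z + z′) * i
        arith = solve-∀

      d : Fin 9 → Fin m → ℤ
      d = comb (+ 1)

      s : Fin 9 → Fin m → ℤ
      s = comb (- + 1)

      gram : ∀ k l → dot (d k) (d l) ≡ rootGram k l
      gram k l = trans (dot-comb (+ 1) (+ 1) k l) (arith (A k l) (I k l))
        where
        arith : ∀ x y → (+ 1 + + 1 * + 1) * (x + + 3 * y) - (+ 1 + + 1) * y ≡ + 2 * (x + + 2 * y)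
        arith = solve-∀

      s⊥d : ∀ l k → dot (d k) (s l) ≡ 0ℤ
      s⊥d l k = trans (dot-comb (+ 1) (- + 1) k l) (arith (A k l + + 3 * I k l) (I k l))
        where
        arith : ∀ x y → (+ 1 + + 1 * - + 1) * x - (+ 1 + - + 1) * y ≡ 0ℤ
        arith = solve-∀

      s≡ : ∀ k j → s k j ≡ b k j * + 2 + d k j
      s≡ k j = arith (a k j) (b k j)
        where
        arith : ∀ x y → + 1 * x - (- + 1) * y ≡ y * + 2 + (+ 1 * x - + 1 * y)
        arith = solve-∀

    -- The points `0F` and `3F` are the adjacent vertices (0 , 0) and (1 , 0), for which the right
    -- side of `dot-comb` evaluates to 2.
    Γ-not-represented : ⊥
    Γ-not-represented = from-no (+ 4 ∣? + 2) (subst (_ ∣_) (dot-comb (- + 1) (- + 1) 0F 3F)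
        (Frame.Glue.4∣dot d gram {b = b 0F} {b′ = b 3F} (s⊥d 0F) (s⊥d 3F) (s≡ 0F) (s≡ 3F)))

-- The smallest eigenvalue

module Spectrum where
  open import Data.Rational.Base using (_+_; _*_; _-_; -_; _≤_; _<_; _/_)
  open FiniteSums (CommutativeRing.semiring ℚ.+-*-commutativeRing)
  open GraphSums Shrikhande
  open +-*-Solver using (solve; _:=_; _:+_; _:*_; _:-_; :-_; con)

  3ℚ -3ℚ ¼ : ℚ
  3ℚ  = ℤ.+ 3 / 1
  -3ℚ = -[1+ 2 ] / 1
  ¼   = 1ℤ / 4

  square-nonneg : ∀ p → 0ℚ ≤ p * p
  square-nonneg p = [ (λ 0≤p → subst (_≤ p * p) (ℚ.*-zeroʳ p) (ℚ.*-monoˡ-≤-nonNeg p {{nonNegative 0≤p}} 0≤p))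
                    , (λ p≤0 → subst (_≤ p * p) (ℚ.*-zeroʳ p) (ℚ.*-monoˡ-≤-nonPos p {{nonPositive p≤0}} p≤0)) ]′ (ℚ.≤-total 0ℚ p)

  product-nonneg : ∀ {p q} → 0ℚ ≤ p → 0ℚ ≤ q → 0ℚ ≤ p * q
  product-nonneg {p} {q} 0≤p 0≤q = subst (_≤ p * q) (ℚ.*-zeroʳ p) (ℚ.*-monoˡ-≤-nonNeg p {{nonNegative 0≤p}} 0≤q)

  sum-mono : ∀ {n} {f g : Fin n → ℚ} → (∀ i → f i ≤ g i) → sum f ≤ sum g
  sum-mono {zero}  f≤g = ℚ.≤-refl
  sum-mono {suc n} f≤g = ℚ.+-mono-≤ (f≤g 0F) (sum-mono (λ i → f≤g (suc i)))

  sum-nonneg : ∀ {n} {f : Fin n → ℚ} → (∀ i → 0ℚ ≤ f i) → 0ℚ ≤ sum f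
  sum-nonneg {n} {f} 0≤f = subst (_≤ sum f) (sum-replicate-zero n) (sum-mono 0≤f)

  term≤sum : ∀ {n} {f : Fin n → ℚ} → (∀ i → 0ℚ ≤ f i) → ∀ i → f i ≤ sum f
  term≤sum {suc n} {f} 0≤f zero =
    subst (_≤ sum f) (ℚ.+-identityʳ (f 0F)) (ℚ.+-monoʳ-≤ (f 0F) (sum-nonneg λ i → 0≤f (suc i)))
  term≤sum {suc n} {f} 0≤f (suc i) = ℚ.≤-trans (term≤sum (λ i → 0≤f (suc i)) i)
    (subst (_≤ sum f) (ℚ.+-identityˡ (sum λ i → f (suc i))) (ℚ.+-monoˡ-≤ (sum λ i → f (suc i)) (0≤f 0F)))

  ∣p∣²≡p² : ∀ p → ∣ p ∣ * ∣ p ∣ ≡ p * p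
  ∣p∣²≡p² p = trans (sym (ℚ.∣p*q∣≡∣p∣*∣q∣ p p)) (ℚ.0≤p⇒∣p∣≡p (square-nonneg p))

  -- The Euclidean norm is at most the sum norm, squared to avoid roots: the cross terms on the
  -- right are nonnegative.
  sum²≤sum∣∣² : ∀ {n} (f : Fin n → ℚ) → sum (λ i → f i * f i) ≤ sum (λ i → ∣ f i ∣) * sum (λ i → ∣ f i ∣)
  sum²≤sum∣∣² {zero}  f = ℚ.≤-refl
  sum²≤sum∣∣² {suc n} f = begin
    x * x + sum (λ i → f (suc i) * f (suc i))  ≤⟨ ℚ.+-monoʳ-≤ (x * x) (sum²≤sum∣∣² (λ i → f (suc i))) ⟩
    x * x + t * t                              ≡⟨ cong (_+ t * t) (∣p∣²≡p² x) ⟨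
    ∣ x ∣ * ∣ x ∣ + t * t                      ≡⟨ ℚ.+-identityʳ _ ⟨
    ∣ x ∣ * ∣ x ∣ + t * t + 0ℚ                 ≤⟨ ℚ.+-monoʳ-≤ (∣ x ∣ * ∣ x ∣ + t * t) cross ⟩
    ∣ x ∣ * ∣ x ∣ + t * t + (∣ x ∣ * t + ∣ x ∣ * t)
      ≡⟨ solve 2 (λ x t → x :* x :+ t :* t :+ (x :* t :+ x :* t) := (x :+ t) :* (x :+ t)) refl ∣ x ∣ t ⟩
    (∣ x ∣ + t) * (∣ x ∣ + t)                  ∎
    where
    open ℚ.≤-Reasoning
    x = f 0F
    t = sum (λ i → ∣ f (suc i) ∣)
    cross : 0ℚ ≤ ∣ x ∣ * t + ∣ x ∣ * t
    cross = ℚ.+-mono-≤ xt xt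
      where
      xt = product-nonneg (ℚ.0≤∣p∣ x) (sum-nonneg λ i → ℚ.0≤∣p∣ (f (suc i)))

  -- Real and imaginary part of the character of ℤ₄ that sends 1 to the imaginary unit.
  ζ₀ ζ₁ : ℤ₄ → ℚ
  ζ₀ 0F = 1ℚ
  ζ₀ 2F = - 1ℚ
  ζ₀ _  = 0ℚ
  ζ₁ 1F = 1ℚ
  ζ₁ 3F = - 1ℚ
  ζ₁ _  = 0ℚ

  -- An orthogonal basis of the eigenspaces of the Shrikhande graph for the eigenvalues 6 and 2.
  ω : Fin 7 → S.Vertex → ℚ
  ω 0F _       = 1ℚ
  ω 1F (a , b) = ζ₀ a
  ω 2F (a , b) = ζ₁ a
  ω 3F (a , b) = ζ₀ b
  ω 4F (a , b) = ζ₁ b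
  ω 5F (a , b) = ζ₀ (a -₄ b)
  ω 6F (a , b) = ζ₁ (a -₄ b)

  -- Spectral decomposition: A + 2I has eigenvalues 8 and 4 on the `ω p`, whose squared norms are 16
  -- and 8, hence the common factor ½; it vanishes on the eigenspace for -2.
  Shrikhande-entry : ∀ x y → S.adjacencyMatrix x y / 1 ≡ ½ * sum (λ p → ω p x * ω p y) - (ℤ.+ 2 / 1) * id# x y
  Shrikhande-entry (a , b) (c , d) = check a b c d
    where
    check : ∀ a b c d → S.adjacencyMatrix (a , b) (c , d) / 1
      ≡ ½ * sum (λ p → ω p (a , b) * ω p (c , d)) - (ℤ.+ 2 / 1) * id# (a , b) (c , d)
    check = from-yes (Fin.all? λ a → Fin.all? λ b → Fin.all? λ c → Fin.all? λ d →
      S.adjacencyMatrix (a , b) (c , d) / 1 ℚ.≟ ½ * sum (λ p → ω p (a , b) * ω p (c , d)) - (ℤ.+ 2 / 1) * id# (a , b) (c , d))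

  shell : S.Vertex → S.Vertex → ℚ
  shell x y = ½ * sum (λ p → ω p x * ω p y)

  -- The quadratic form of A(Γ_t) + 3I.

  module _ (t : ℕ) where

    Γ-entry : ∀ x i y j → G.adjacencyMatrix t (x , i) (y , j) / 1 ≡ 𝟙 i j * (shell x y - 3ℚ * id# x y) + id# x y
    Γ-entry x i y j = by-copy (i Fin.≟ j)
      where
      open ≡-Reasoning
      cast : ∀ b → (if b then 1ℤ else 0ℤ) / 1 ≡ (if b then 1ℚ else 0ℚ)
      cast true  = refl
      cast false = refl
      by-copy : Dec (i ≡ j) → G.adjacencyMatrix t (x , i) (y , j) / 1 ≡ 𝟙 i j * (shell x y - 3ℚ * id# x y) + id# x y
      by-copy (yes refl) = begin
        G.adjacencyMatrix t (x , i) (y , i) / 1                                  ≡⟨ cong (_/ 1) (adjacency-copy t x y i) ⟩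
        S.adjacencyMatrix x y / 1                              ≡⟨ Shrikhande-entry x y ⟩
        shell x y - (ℤ.+ 2 / 1) * id# x y                      ≡⟨ arith (shell x y) (id# x y) ⟩
        1ℚ * (shell x y - 3ℚ * id# x y) + id# x y              ≡⟨ cong (λ z → z * (shell x y - 3ℚ * id# x y) + id# x y) (𝟙-refl i) ⟨
        𝟙 i i * (shell x y - 3ℚ * id# x y) + id# x y           ∎
        where
        arith : ∀ e d → e - (ℤ.+ 2 / 1) * d ≡ 1ℚ * (e - 3ℚ * d) + d
        arith = solve 2 (λ e d → e :- con (ℤ.+ 2 / 1) :* d := con 1ℚ :* (e :- con 3ℚ :* d) :+ d) refl
      by-copy (no i≢j) = begin
        G.adjacencyMatrix t (x , i) (y , j) / 1                                  ≡⟨ cong (_/ 1) (adjacency-copies t x y i≢j) ⟩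
        S.identityMatrix x y / 1                               ≡⟨ cast (does (x S.≟ y)) ⟩
        id# x y                                                ≡⟨ arith (shell x y - 3ℚ * id# x y) (id# x y) ⟩
        0ℚ * (shell x y - 3ℚ * id# x y) + id# x y              ≡⟨ cong (λ b → (if b then 1ℚ else 0ℚ) * (shell x y - 3ℚ * id# x y) + id# x y) (dec-false (i Fin.≟ j) i≢j) ⟨
        𝟙 i j * (shell x y - 3ℚ * id# x y) + id# x y           ∎
        where
        arith : ∀ z d → d ≡ 0ℚ * z + d
        arith = solve 2 (λ z d → d := con 0ℚ :* z :+ d) refl

    module _ (v : S.Vertex × Fin t → ℚ) where
      open ≡-Reasoning

      Av : S.Vertex × Fin t → ℚ
      Av u = sum (λ k → G.adjacencyMatrix t u (G.vertex t k) / 1 * v (G.vertex t k))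

      W : Fin 7 → Fin t → ℚ
      W p i = sum (λ y → ω p (S.vertex y) * v (S.vertex y , i))

      R : S.Vertex → ℚ
      R x = sum (λ j → v (x , j))

      -- By `action` this is (A(Γ_t) + 3I) v; its terms come from (A + 2I) ⊗ I and I ⊗ J.
      shift : S.Vertex → Fin t → ℚ
      shift x i = ½ * sum (λ p → ω p x * W p i) + R x

      private
        inner : ∀ x i y → sum (λ j → G.adjacencyMatrix t (x , i) (y , j) / 1 * v (y , j))
                        ≡ ½ * (sum (λ p → ω p x * ω p y) * v (y , i)) + (id# x y * (- 3ℚ * v (y , i) + R y))
        inner x i y = begin
          sum (λ j → G.adjacencyMatrix t (x , i) (y , j) / 1 * v (y , j))
            ≡⟨ sum-cong (λ j → trans (cong (_* v (y , j)) (Γ-entry x i y j)) (expand (𝟙 i j) F D (v (y , j)))) ⟩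
          sum (λ j → 𝟙 i j * (F * v (y , j)) + D * v (y , j))
            ≡⟨ ∑-distrib-+ (λ j → 𝟙 i j * (F * v (y , j))) (λ j → D * v (y , j)) ⟩
          sum (λ j → 𝟙 i j * (F * v (y , j))) + sum (λ j → D * v (y , j))
            ≡⟨ cong₂ _+_ (sum-𝟙 i (λ j → F * v (y , j))) (sym (*-distribˡ-sum D (λ j → v (y , j)))) ⟩
          F * v (y , i) + D * R y
            ≡⟨ regroup (sum (λ p → ω p x * ω p y)) D (v (y , i)) (R y) ⟩
          ½ * (sum (λ p → ω p x * ω p y) * v (y , i)) + D * (- 3ℚ * v (y , i) + R y) ∎
          where
          D = id# x y
          F = shell x y - 3ℚ * D
          expand : ∀ d f e z → (d * f + e) * z ≡ d * (f * z) + e * z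
          expand = solve 4 (λ d f e z → (d :* f :+ e) :* z := d :* (f :* z) :+ e :* z) refl
          regroup : ∀ s d z r → (½ * s - 3ℚ * d) * z + d * r ≡ ½ * (s * z) + d * (- 3ℚ * z + r)
          regroup = solve 4 (λ s d z r → (con ½ :* s :- con 3ℚ :* d) :* z :+ d :* r
                                       := con ½ :* (s :* z) :+ d :* (con (- 3ℚ) :* z :+ r)) refl

      action : ∀ x i → Av (x , i) ≡ - 3ℚ * v (x , i) + shift x i
      action x i = begin
        Av (x , i)
          ≡⟨ sum-□K Shrikhande t (λ w → G.adjacencyMatrix t (x , i) w / 1 * v w) ⟩
        sum (λ y → sum (λ j → G.adjacencyMatrix t (x , i) (S.vertex y , j) / 1 * v (S.vertex y , j)))
          ≡⟨ sum-cong (λ y → inner x i (S.vertex y)) ⟩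
        sum (λ y → ½ * P y + id# x (S.vertex y) * Q (S.vertex y))
          ≡⟨ ∑-distrib-+ (λ y → ½ * P y) (λ y → id# x (S.vertex y) * Q (S.vertex y)) ⟩
        sum (λ y → ½ * P y) + sum (λ y → id# x (S.vertex y) * Q (S.vertex y))
          ≡⟨ cong₂ _+_ (trans (sym (*-distribˡ-sum ½ P)) (cong (½ *_) swap)) (sum-id# x Q) ⟩
        ½ * sum (λ p → ω p x * W p i) + (- 3ℚ * v (x , i) + R x)
          ≡⟨ solve 3 (λ a b c → a :+ (b :+ c) := b :+ (a :+ c)) refl (½ * sum (λ p → ω p x * W p i)) (- 3ℚ * v (x , i)) (R x) ⟩
        - 3ℚ * v (x , i) + shift x i ∎
        where
        P : Fin 16 → ℚ
        P y = sum (λ p → ω p x * ω p (S.vertex y)) * v (S.vertex y , i)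
        Q : S.Vertex → ℚ
        Q y = - 3ℚ * v (y , i) + R y
        swap : sum P ≡ sum (λ p → ω p x * W p i)
        swap = begin
          sum P
            ≡⟨ sum-cong (λ y → *-distribʳ-sum (v (S.vertex y , i)) (λ p → ω p x * ω p (S.vertex y))) ⟩
          sum (λ y → sum (λ p → ω p x * ω p (S.vertex y) * v (S.vertex y , i)))
            ≡⟨ ∑-comm (λ y p → ω p x * ω p (S.vertex y) * v (S.vertex y , i)) ⟩
          sum (λ p → sum (λ y → ω p x * ω p (S.vertex y) * v (S.vertex y , i)))
            ≡⟨ sum-cong (λ p → trans (sum-cong λ y → ℚ.*-assoc (ω p x) (ω p (S.vertex y)) (v (S.vertex y , i)))
                                      (sym (*-distribˡ-sum (ω p x) (λ y → ω p (S.vertex y) * v (S.vertex y , i))))) ⟩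
          sum (λ p → ω p x * W p i) ∎

      form : ℚ
      form = sum (λ k → v (G.vertex t k) * (Av (G.vertex t k) + 3ℚ * v (G.vertex t k)))

      -- Interchanging sums collects the first term of `shift` into squares of `W` and the second
      -- into squares of `R`.
      form-squares : form ≡ sum (λ i → ½ * sum (λ p → W p i * W p i)) + sum (λ x → R (S.vertex x) * R (S.vertex x))
      form-squares = begin
        form
          ≡⟨ sum-□K Shrikhande t (λ w → v w * (Av w + 3ℚ * v w)) ⟩
        sum (λ x → sum (λ i → v (sv x , i) * (Av (sv x , i) + 3ℚ * v (sv x , i))))
          ≡⟨ sum-cong (λ x → trans
               (sum-cong λ i → trans (cong (λ z → v (sv x , i) * (z + 3ℚ * v (sv x , i))) (action (sv x) i))
                                     (expand (v (sv x , i)) (½ * U x i) (R (sv x))))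
               (trans (∑-distrib-+ (λ i → v (sv x , i) * (½ * U x i)) (λ i → v (sv x , i) * R (sv x)))
                      (cong (sum (λ i → v (sv x , i) * (½ * U x i)) +_) (sym (*-distribʳ-sum (R (sv x)) (λ i → v (sv x , i))))))) ⟩
        sum (λ x → sum (λ i → v (sv x , i) * (½ * U x i)) + R (sv x) * R (sv x))
          ≡⟨ ∑-distrib-+ (λ x → sum (λ i → v (sv x , i) * (½ * U x i))) (λ x → R (sv x) * R (sv x)) ⟩
        sum (λ x → sum (λ i → v (sv x , i) * (½ * U x i))) + sum (λ x → R (sv x) * R (sv x))
          ≡⟨ cong (_+ sum (λ x → R (sv x) * R (sv x))) (trans (∑-comm (λ x i → v (sv x , i) * (½ * U x i))) (sum-cong collect)) ⟩
        sum (λ i → ½ * sum (λ p → W p i * W p i)) + sum (λ x → R (sv x) * R (sv x)) ∎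
        where
        sv = S.vertex
        U : Fin 16 → Fin t → ℚ
        U x i = sum (λ p → ω p (sv x) * W p i)
        expand : ∀ z a r → z * (- 3ℚ * z + (a + r) + 3ℚ * z) ≡ z * a + z * r
        expand = solve 3 (λ z a r → z :* (con (- 3ℚ) :* z :+ (a :+ r) :+ con 3ℚ :* z) := z :* a :+ z :* r) refl
        collect : ∀ i → sum (λ x → v (sv x , i) * (½ * U x i)) ≡ ½ * sum (λ p → W p i * W p i)
        collect i = begin
          sum (λ x → v (sv x , i) * (½ * U x i))
            ≡⟨ sum-cong (λ x → swap½ (v (sv x , i)) (U x i)) ⟩
          sum (λ x → ½ * (v (sv x , i) * U x i))
            ≡⟨ *-distribˡ-sum ½ (λ x → v (sv x , i) * U x i) ⟨
          ½ * sum (λ x → v (sv x , i) * U x i)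
            ≡⟨ cong (½ *_) (begin
              sum (λ x → v (sv x , i) * U x i)
                ≡⟨ sum-cong (λ x → *-distribˡ-sum (v (sv x , i)) (λ p → ω p (sv x) * W p i)) ⟩
              sum (λ x → sum (λ p → v (sv x , i) * (ω p (sv x) * W p i)))
                ≡⟨ ∑-comm (λ x p → v (sv x , i) * (ω p (sv x) * W p i)) ⟩
              sum (λ p → sum (λ x → v (sv x , i) * (ω p (sv x) * W p i)))
                ≡⟨ sum-cong (λ p → trans
                     (sum-cong λ x → rotate (v (sv x , i)) (ω p (sv x)) (W p i))
                     (sym (*-distribʳ-sum (W p i) (λ x → ω p (sv x) * v (sv x , i))))) ⟩
              sum (λ p → W p i * W p i) ∎) ⟩
          ½ * sum (λ p → W p i * W p i) ∎
          where
          swap½ : ∀ a b → a * (½ * b) ≡ ½ * (a * b)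
          swap½ = solve 2 (λ a b → a :* (con ½ :* b) := con ½ :* (a :* b)) refl
          rotate : ∀ a b c → a * (b * c) ≡ b * a * c
          rotate = solve 3 (λ a b c → a :* (b :* c) := b :* a :* c) refl

      form-nonneg : 0ℚ ≤ form
      form-nonneg = subst (0ℚ ≤_) (sym form-squares) (ℚ.+-mono-≤
        (sum-nonneg λ i → product-nonneg (ℚ.nonNegative⁻¹ ½) (sum-nonneg λ p → square-nonneg (W p i)))
        (sum-nonneg λ x → square-nonneg (R (S.vertex x))))

      -- Since A(Γ_t) + 3I is positive semidefinite, the norm of (A(Γ_t) - μ) v is at least δ times
      -- that of v. The bound is quantitative because rational approximations of a real eigenpair
      -- leave a nonzero residual.
      residual-bound : ∀ μ δ → 0ℚ ≤ δ → δ ≤ - (μ + 3ℚ) → ∀ k →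
        (δ * δ) * (v (G.vertex t k) * v (G.vertex t k))
          ≤ sum (λ k → (Av (G.vertex t k) - μ * v (G.vertex t k)) * (Av (G.vertex t k) - μ * v (G.vertex t k)))
      residual-bound μ δ 0≤δ δ≤ k = ℚ.≤-trans
        (term≤sum {f = λ k → (δ * δ) * (z k * z k)} (λ k → product-nonneg (square-nonneg δ) (square-nonneg (z k))) k)
        total
        where
        z r : Fin (16 ℕ.* t) → ℚ
        z k = v (G.vertex t k)
        r k = Av (G.vertex t k) - μ * z k
        termwise : ∀ k → (δ * δ) * (z k * z k) + (δ + δ) * (z k * (Av (G.vertex t k) + 3ℚ * z k)) ≤ r k * r k
        termwise k = subst₂ _≤_ (ℚ.+-identityʳ lhs) (complete δ μ (z k) (Av (G.vertex t k)))
          (ℚ.+-monoʳ-≤ lhs (ℚ.+-mono-≤ (square-nonneg (r k - δ * z k))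
            (product-nonneg (ℚ.+-mono-≤ 0≤δ 0≤δ) (product-nonneg gap (square-nonneg (z k))))))
          where
          lhs = (δ * δ) * (z k * z k) + (δ + δ) * (z k * (Av (G.vertex t k) + 3ℚ * z k))
          -- Completing the square in r - δ z.
          complete : ∀ d m z a → (d * d) * (z * z) + (d + d) * (z * (a + 3ℚ * z))
            + (((a - m * z) - d * z) * ((a - m * z) - d * z) + (d + d) * ((- (m + 3ℚ) - d) * (z * z)))
            ≡ (a - m * z) * (a - m * z)
          complete = solve 4 (λ d m z a →
            (d :* d) :* (z :* z) :+ (d :+ d) :* (z :* (a :+ con 3ℚ :* z))
              :+ (((a :- m :* z) :- d :* z) :* ((a :- m :* z) :- d :* z) :+ (d :+ d) :* ((:- (m :+ con 3ℚ) :- d) :* (z :* z)))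
            := (a :- m :* z) :* (a :- m :* z)) refl
          gap : 0ℚ ≤ - (μ + 3ℚ) - δ
          gap = subst (_≤ - (μ + 3ℚ) - δ) (ℚ.+-inverseʳ δ) (ℚ.+-monoˡ-≤ (- δ) δ≤)
        total : sum (λ k → (δ * δ) * (z k * z k)) ≤ sum (λ k → r k * r k)
        total = ℚ.≤-trans
          (subst (_≤ sum (λ k → (δ * δ) * (z k * z k)) + (δ + δ) * form) (ℚ.+-identityʳ _)
            (ℚ.+-monoʳ-≤ (sum (λ k → (δ * δ) * (z k * z k))) (product-nonneg (ℚ.+-mono-≤ 0≤δ 0≤δ) form-nonneg)))
          (subst (_≤ sum (λ k → r k * r k))
            (trans (∑-distrib-+ (λ k → (δ * δ) * (z k * z k)) (λ k → (δ + δ) * (z k * (Av (G.vertex t k) + 3ℚ * z k))))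
                   (cong (sum (λ k → (δ * δ) * (z k * z k)) +_)
                         (sym (*-distribˡ-sum (δ + δ) (λ k → z k * (Av (G.vertex t k) + 3ℚ * z k))))))
            (sum-mono termwise))

  -- Passage from rational approximations to real eigenvalues.

  seq-sumℝ : ∀ {n} (f : Fin n → ℝ) k → seq (sumℝ f) k ≡ sum (λ i → seq (f i) k)
  seq-sumℝ {zero}  f k = refl
  seq-sumℝ {suc n} f k = cong (seq (f 0F) k +_) (seq-sumℝ (λ i → f (suc i)) k)

  seq-combination : ∀ {n} (a : Fin n → ℤ) (x : Fin n → ℝ) k →
    seq (sumℝ (λ i → fromℤ (a i) *ℝ x i)) k ≡ sum (λ i → a i / 1 * seq (x i) k)
  seq-combination a x k = seq-sumℝ (λ i → fromℤ (a i) *ℝ x i) k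

  half-pos : ∀ {e} → 0ℚ < e → 0ℚ < ½ * e
  half-pos {e} e>0 = subst (_< ½ * e) (ℚ.*-zeroʳ ½) (ℚ.*-monoʳ-<-pos ½ e>0)

  halves : ∀ e → ½ * e + ½ * e ≡ e
  halves = solve 1 (λ e → con ½ :* e :+ con ½ :* e := e) refl

  p≤∣p∣ : ∀ p → p ≤ ∣ p ∣
  p≤∣p∣ p = [ (λ 0≤p → ℚ.≤-reflexive (sym (ℚ.0≤p⇒∣p∣≡p 0≤p))) , (λ p≤0 → ℚ.≤-trans p≤0 (ℚ.0≤∣p∣ p)) ]′ (ℚ.≤-total 0ℚ p)

  ∣p-q∣<r⇒p<q+r : ∀ p q {r} → ∣ p - q ∣ < r → p < q + r
  ∣p-q∣<r⇒p<q+r p q {r} h = subst (_< q + r) (solve 2 (λ p q → q :+ (p :- q) := p) refl p q)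
    (ℚ.+-monoʳ-< q (ℚ.≤-<-trans (p≤∣p∣ (p - q)) h))

  Eventually : (ℕ → Set) → Set
  Eventually P = ∃[ N ] (∀ n → N ℕ.≤ n → P n)

  eventually-both : ∀ {P Q R : ℕ → Set} → Eventually P → Eventually Q → (∀ n → P n → Q n → R n) → Eventually R
  eventually-both (M , p) (N , q) f = M ⊔ N , λ n ≤n → f n (p n (ℕ.m⊔n≤o⇒m≤o M N ≤n)) (q n (ℕ.m⊔n≤o⇒n≤o M N ≤n))

  sum-eventually-small : ∀ {m} (f : Fin m → ℕ → ℚ) →
    (∀ i e → 0ℚ < e → Eventually (λ n → f i n < e)) →
    ∀ e → 0ℚ < e → Eventually (λ n → sum (λ i → f i n) < e)
  sum-eventually-small {zero}  f small e e>0 = 0 , λ _ _ → e>0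
  sum-eventually-small {suc m} f small e e>0 = eventually-both
    (small 0F (½ * e) (half-pos e>0))
    (sum-eventually-small (λ i → f (suc i)) (λ i → small (suc i)) (½ * e) (half-pos e>0))
    λ n p q → subst (_ <_) (halves e) (ℚ.+-mono-< p q)

  -- An index N with error e/4 decides constructively: either q is at most x + e from N on, or x
  -- stays below q by the margin e/4, which is refuted.
  rational≤ℝ : ∀ q (x : ℝ) →
    (∀ d → 0ℚ < d → Eventually (λ n → seq x n + d ≤ q) → ⊥) → fromℚ q ≤ℝ x
  rational≤ℝ q x not-below e e>0 with cauchy x (½ * (½ * e)) (half-pos (half-pos e>0))
  ... | N , close with q ℚ.≤? seq x N + ½ * e
  ...   | yes q≤ = N , λ n N≤n → begin
    q                                 ≤⟨ q≤ ⟩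
    seq x N + ½ * e                   ≤⟨ ℚ.+-monoˡ-≤ (½ * e) (ℚ.<⇒≤ (∣p-q∣<r⇒p<q+r (seq x N) (seq x n) (close N n ℕ.≤-refl N≤n))) ⟩
    seq x n + ½ * (½ * e) + ½ * e     ≤⟨ ℚ.+-monoˡ-≤ (½ * e) (ℚ.+-monoʳ-≤ (seq x n) quarter≤half) ⟩
    seq x n + ½ * e + ½ * e           ≡⟨ ℚ.+-assoc (seq x n) (½ * e) (½ * e) ⟩
    seq x n + (½ * e + ½ * e)         ≡⟨ cong (seq x n +_) (halves e) ⟩
    seq x n + e                       ∎
    where
    open ℚ.≤-Reasoning
    quarter≤half : ½ * (½ * e) ≤ ½ * e
    quarter≤half = subst₂ _≤_ (ℚ.+-identityʳ _) (halves (½ * e)) (ℚ.+-monoʳ-≤ (½ * (½ * e)) (ℚ.<⇒≤ (half-pos (half-pos e>0))))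
  ...   | no q≰ = contradiction (N , λ n N≤n → begin
    seq x n + ½ * (½ * e)                   ≤⟨ ℚ.+-monoˡ-≤ (½ * (½ * e)) (ℚ.<⇒≤ (∣p-q∣<r⇒p<q+r (seq x n) (seq x N) (close n N N≤n ℕ.≤-refl))) ⟩
    seq x N + ½ * (½ * e) + ½ * (½ * e)     ≡⟨ ℚ.+-assoc (seq x N) (½ * (½ * e)) (½ * (½ * e)) ⟩
    seq x N + (½ * (½ * e) + ½ * (½ * e))   ≡⟨ cong (seq x N +_) (halves (½ * e)) ⟩
    seq x N + ½ * e                         ≤⟨ ℚ.<⇒≤ (ℚ.≰⇒> q≰) ⟩
    q                                       ∎) (not-below (½ * (½ * e)) (half-pos (half-pos e>0)))
    where open ℚ.≤-Reasoning

  squares-reflect-< : ∀ {p q r} → 0ℚ < p → 0ℚ < q → (p * p) * (r * r) < (p * q) * (p * q) → ∣ r ∣ < q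
  squares-reflect-< {p} {q} {r} p>0 q>0 h with ∣ r ∣ ℚ.<? q
  ... | yes lt = lt
  ... | no ≮q = contradiction (ℚ.<-≤-trans h (begin
    (p * q) * (p * q)      ≡⟨ solve 2 (λ p q → (p :* q) :* (p :* q) := (p :* p) :* (q :* q)) refl p q ⟩
    (p * p) * (q * q)      ≤⟨ ℚ.*-monoˡ-≤-nonNeg (p * p) {{nonNegative (square-nonneg p)}} q²≤r² ⟩
    (p * p) * (r * r)      ∎)) (ℚ.<-irrefl refl)
    where
    open ℚ.≤-Reasoning
    q≤∣r∣ = ℚ.≮⇒≥ ≮q
    q²≤r² : q * q ≤ r * r
    q²≤r² = begin
      q * q            ≤⟨ ℚ.*-monoˡ-≤-nonNeg q {{nonNegative (ℚ.<⇒≤ q>0)}} q≤∣r∣ ⟩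
      q * ∣ r ∣        ≤⟨ ℚ.*-monoʳ-≤-nonNeg ∣ r ∣ {{nonNegative (ℚ.0≤∣p∣ r)}} q≤∣r∣ ⟩
      ∣ r ∣ * ∣ r ∣    ≡⟨ ∣p∣²≡p² r ⟩
      r * r            ∎

  product-pos : ∀ {p q} → 0ℚ < p → 0ℚ < q → 0ℚ < p * q
  product-pos {p} {q} p>0 q>0 = subst (_< p * q) (ℚ.*-zeroʳ p) (ℚ.*-monoʳ-<-pos p {{positive p>0}} q>0)

  square-mono-< : ∀ {p q} → 0ℚ ≤ p → p < q → p * p < q * q
  square-mono-< {p} {q} 0≤p p<q = ℚ.≤-<-trans
    (ℚ.*-monoˡ-≤-nonNeg p {{nonNegative 0≤p}} (ℚ.<⇒≤ p<q))
    (ℚ.*-monoˡ-<-pos q {{positive (ℚ.≤-<-trans 0≤p p<q)}} p<q)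

  -- Eventually d times the absolute value of x is at most the sum of the absolute values of r, and
  -- this sum is less than d e.
  dominated-vanishes : ∀ {m} (x : ℕ → ℚ) (r : ℕ → Fin m → ℚ) d → 0ℚ < d →
    Eventually (λ n → (d * d) * (x n * x n) ≤ sum (λ k → r n k * r n k)) →
    (∀ k e → 0ℚ < e → Eventually (λ n → ∣ r n k ∣ < e)) →
    ∀ e → 0ℚ < e → Eventually (λ n → ∣ x n - 0ℚ ∣ < e)
  dominated-vanishes x r d d>0 dominated r-small e e>0 = eventually-both dominated
    (sum-eventually-small (λ k n → ∣ r n k ∣) r-small (d * e) (product-pos d>0 e>0))
    λ n bound small → subst (_< e) (cong ∣_∣ (sym (ℚ.+-identityʳ (x n))))
      (squares-reflect-< {d} {e} {x n} d>0 e>0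
        (ℚ.≤-<-trans bound (ℚ.≤-<-trans (sum²≤sum∣∣² (r n)) (square-mono-< (sum-nonneg λ k → ℚ.0≤∣p∣ (r n k)) small))))

  module _ (t : ℕ) (v : Graph.Vertex (Γ t) → ℝ) where

    adjacency-action : Graph.Vertex (Γ t) → ℝ
    adjacency-action x = sumℝ (λ k → fromℤ (G.adjacencyMatrix t x (G.vertex t k)) *ℝ v (G.vertex t k))

    seq-action : ∀ x n → seq (adjacency-action x) n ≡ Av t (λ y → seq (v y) n) x
    seq-action x n = seq-combination (λ k → G.adjacencyMatrix t x (G.vertex t k)) (λ k → v (G.vertex t k)) n

    module _ (μ : ℝ) (eigen : ∀ x → adjacency-action x ≈ μ *ℝ v x) where

      residual-small : ∀ x e → 0ℚ < e → Eventually (λ n → ∣ Av t (λ y → seq (v y) n) x - seq μ n * seq (v x) n ∣ < e)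
      residual-small x e e>0 = proj₁ (eigen x e e>0) , λ n N≤n →
        transport (seq (adjacency-action x) n) (Av t (λ y → seq (v y) n) x) (seq μ n * seq (v x) n) e
          (seq-action x n) (proj₂ (eigen x e e>0) n N≤n)
        where
        transport : ∀ a b c e → a ≡ b → ∣ a - c ∣ < e → ∣ b - c ∣ < e
        transport a b c e refl h = h

      -- The eigenvalue equation makes the residuals tend to zero, while `residual-bound` bounds
      -- each coordinate of v by them.
      eigenvector-vanishes : ∀ d → 0ℚ < d → Eventually (λ n → seq μ n + d ≤ -3ℚ) → ∀ x → v x ≈ 0ℝ
      eigenvector-vanishes d d>0 (M , below) x = subst (λ y → v y ≈ 0ℝ) (Inverse.strictlyInverseˡ (G.enum t) x)
        (dominated-vanishes (λ n → seq (v (G.vertex t k₀)) n)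
          (λ n k → Av t (λ y → seq (v y) n) (G.vertex t k) - seq μ n * seq (v (G.vertex t k)) n) d d>0
          (M , λ n M≤n → residual-bound t (λ y → seq (v y) n) (seq μ n) d (ℚ.<⇒≤ d>0) (gap (seq μ n) (below n M≤n)) k₀)
          (λ k → residual-small (G.vertex t k)))
        where
        k₀ = Inverse.from (G.enum t) x
        gap : ∀ m → m + d ≤ -3ℚ → d ≤ - (m + 3ℚ)
        gap m h = subst₂ _≤_ (solve 2 (λ m d → m :+ d :- m := d) refl m d)
          (solve 1 (λ m → con -3ℚ :- m := :- (m :+ con 3ℚ)) refl m) (ℚ.+-monoˡ-≤ (- m) h)

  eigenvalue≥-3 : ∀ t μ → IsEigenvalue (Γ t) μ → fromℤ -[1+ 2 ] ≤ℝ μ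
  eigenvalue≥-3 t μ (v , v≉0 , eigen) = rational≤ℝ -3ℚ μ λ d d>0 below →
    v≉0 (eigenvector-vanishes t v μ eigen d d>0 below)

  -- An eigenvector for -3.

  alternating : S.Vertex → ℚ
  alternating (0F , 0F) = 1ℚ
  alternating (1F , 0F) = - 1ℚ
  alternating (2F , 0F) = 1ℚ
  alternating (3F , 0F) = - 1ℚ
  alternating _         = 0ℚ

  -- An eigenvector of the complete graph for -1, while `alternating` is one of the Shrikhande graph
  -- for -2; the eigenvalues add up to -3.
  difference : ∀ {t} → Fin (suc (suc t)) → ℚ
  difference 0F            = 1ℚ
  difference 1F            = - 1ℚ
  difference (suc (suc _)) = 0ℚ

  module _ (t : ℕ) where

    ψ : S.Vertex × Fin (suc (suc t)) → ℚ
    ψ (x , i) = alternating x * difference i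

    ψ-eigenvector : ∀ x → Av (suc (suc t)) ψ x ≡ -3ℚ * ψ x
    ψ-eigenvector (x , i) = trans (action (suc (suc t)) ψ x i) (trans
      -- Both parts of `shift` vanish: `alternating` is orthogonal to every `ω p`, and `difference`
      -- sums to zero.
      (cong (- 3ℚ * ψ (x , i) +_) (cong₂ (λ a b → ½ * a + b)
        (trans (sum-cong λ p → trans (cong (ω p x *_) (W≡0 p)) (ℚ.*-zeroʳ (ω p x))) (sum-replicate-zero 7))
        R≡0))
      (ℚ.+-identityʳ _))
      where
      ω⊥alternating : ∀ p → sum (λ y → ω p (S.vertex y) * alternating (S.vertex y)) ≡ 0ℚ
      ω⊥alternating = from-yes (Fin.all? λ p → sum (λ y → ω p (S.vertex y) * alternating (S.vertex y)) ℚ.≟ 0ℚ)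
      W≡0 : ∀ p → W (suc (suc t)) ψ p i ≡ 0ℚ
      W≡0 p = trans (sum-cong λ y → sym (ℚ.*-assoc (ω p (S.vertex y)) (alternating (S.vertex y)) (difference i)))
        (trans (sym (*-distribʳ-sum (difference i) (λ y → ω p (S.vertex y) * alternating (S.vertex y))))
          (trans (cong (_* difference i) (ω⊥alternating p)) (ℚ.*-zeroˡ (difference i))))
      R≡0 : R (suc (suc t)) ψ x ≡ 0ℚ
      R≡0 = trans (sym (*-distribˡ-sum (alternating x) (difference {t})))
        (trans (cong (λ s → alternating x * (1ℚ + (- 1ℚ + s))) (sum-replicate-zero t)) (ℚ.*-zeroʳ (alternating x)))

    eigenvalue-3 : IsEigenvalue (Γ (suc (suc t))) (fromℤ -[1+ 2 ])
    eigenvalue-3 = (λ x → fromℚ (ψ x))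
      , (λ ψ≈0 → let N , h = ψ≈0 ((0F , 0F) , 0F) ½ (ℚ.positive⁻¹ ½) in from-no (1ℚ ℚ.<? ½) (h N ℕ.≤-refl))
      , λ x e e>0 → 0 , λ n _ → subst (_< e) (sym (cong ∣_∣ (trans
          (cong (_- -3ℚ * ψ x) (trans (seq-sumℝ (λ k → fromℤ (G.adjacencyMatrix (suc (suc t)) x (G.vertex (suc (suc t)) k)) *ℝ fromℚ (ψ (G.vertex (suc (suc t)) k))) n)
                                      (ψ-eigenvector x)))
          (ℚ.+-inverseʳ (-3ℚ * ψ x))))) e>0

    Γ-smallest-eigenvalue : IsSmallestEigenvalue (Γ (suc (suc t))) (fromℤ -[1+ 2 ])
    Γ-smallest-eigenvalue = eigenvalue-3 , λ μ → eigenvalue≥-3 (suc (suc t)) μ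

  -- The ceiling and the reduction to integral Gram matrices.

  /1-reflects-< : ∀ a b → a / 1 < b / 1 → a ℤ.< b
  /1-reflects-< a b h with ℚᵘ.<-respˡ-≃ (ℚ.toℚᵘ-fromℚᵘ (ℚᵘ.mkℚᵘ a 0)) (ℚᵘ.<-respʳ-≃ (ℚ.toℚᵘ-fromℚᵘ (ℚᵘ.mkℚᵘ b 0)) (ℚ.toℚᵘ-mono-< h))
  ... | ℚᵘ.*<* a<b = subst₂ ℤ._<_ (ℤ.*-identityʳ a) (ℤ.*-identityʳ b) a<b

  /1-injective : ∀ {a b} → a / 1 ≡ b / 1 → a ≡ b
  /1-injective {a} {b} eq with ℚ./-injective-≃ (ℚᵘ.mkℚᵘ a 0) (ℚᵘ.mkℚᵘ b 0) eq
  ... | ℚᵘ.*≡* a≡b = trans (sym (ℤ.*-identityʳ a)) (trans a≡b (ℤ.*-identityʳ b))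

  -- Two tolerances of ¼ leave 3 - ½, which still exceeds 2.
  -3-lower : ∀ x y → x ≤ -3ℚ + ¼ → - x ≤ y + ¼ → ℤ.+ 2 / 1 < y
  -3-lower x y x≤ -x≤ = begin-strict
    ℤ.+ 2 / 1             <⟨ from-yes (ℤ.+ 2 / 1 ℚ.<? - (-3ℚ + ¼) + - ¼) ⟩
    - (-3ℚ + ¼) + - ¼     ≤⟨ ℚ.+-monoˡ-≤ (- ¼) (ℚ.neg-antimono-≤ x≤) ⟩
    - x + - ¼             ≤⟨ ℚ.+-monoˡ-≤ (- ¼) -x≤ ⟩
    y + ¼ + - ¼           ≡⟨ ℚ.+-assoc y ¼ (- ¼) ⟩
    y + 0ℚ                ≡⟨ ℚ.+-identityʳ y ⟩
    y                     ∎
    where open ℚ.≤-Reasoning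

  -- The margin e in the strict inequality of `IsCeiling` absorbs the tolerance e/2.
  -3-upper : ∀ x y e → 0ℚ < e → -3ℚ ≤ x + ½ * e → y - 1ℚ + e ≤ - x → y < ℤ.+ 4 / 1
  -3-upper x y e e>0 -3≤ ≤-x = begin-strict
    y                                       ≡⟨ solve 3 (λ x y e → y := ((y :- con 1ℚ) :+ e) :+ (con 1ℚ :- e)) refl x y e ⟩
    (y - 1ℚ + e) + (1ℚ - e)                 ≤⟨ ℚ.+-monoˡ-≤ (1ℚ - e) ≤-x ⟩
    - x + (1ℚ - e)                          ≡⟨ solve 2 (λ x e → :- x :+ (con 1ℚ :- e) := con -3ℚ :+ (con (ℤ.+ 4 / 1) :- x :- e)) refl x e ⟩
    -3ℚ + (ℤ.+ 4 / 1 - x - e)               ≤⟨ ℚ.+-monoˡ-≤ (ℤ.+ 4 / 1 - x - e) -3≤ ⟩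
    x + ½ * e + (ℤ.+ 4 / 1 - x - e)         ≡⟨ solve 2 (λ x e → x :+ con ½ :* e :+ (con (ℤ.+ 4 / 1) :- x :- e) := con (ℤ.+ 4 / 1) :+ :- (con ½ :* e)) refl x e ⟩
    ℤ.+ 4 / 1 + - (½ * e)                   <⟨ ℚ.+-monoʳ-< (ℤ.+ 4 / 1) (ℚ.neg-antimono-< (half-pos e>0)) ⟩
    ℤ.+ 4 / 1 + 0ℚ                          ≡⟨ ℚ.+-identityʳ (ℤ.+ 4 / 1) ⟩
    ℤ.+ 4 / 1                               ∎
    where open ℚ.≤-Reasoning

  ceiling≡3 : ∀ {θ c} → θ ≤ℝ fromℤ -[1+ 2 ] → fromℤ -[1+ 2 ] ≤ℝ θ → IsCeiling (-ℝ θ) c → c ≡ ℤ.+ 3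
  ceiling≡3 {θ} {c} θ≤-3 -3≤θ (-θ≤c , e , e>0 , c-1+e≤-θ) = ℤ.≤-antisym
    -- The bounds 2 < c < 4 do not depend on the index, so each is read off at its own threshold.
    (ℤ.i<j⇒i≤pred[j] (/1-reflects-< c (ℤ.+ 4) (proj₂ above (proj₁ above) ℕ.≤-refl)))
    (ℤ.i<j⇒suc[i]≤j (/1-reflects-< (ℤ.+ 2) c (proj₂ below (proj₁ below) ℕ.≤-refl)))
    where
    below : Eventually (λ _ → ℤ.+ 2 / 1 < c / 1)
    below = eventually-both (θ≤-3 ¼ (ℚ.positive⁻¹ ¼)) (-θ≤c ¼ (ℚ.positive⁻¹ ¼)) λ n → -3-lower (seq θ n) (c / 1)
    above : Eventually (λ _ → c / 1 < ℤ.+ 4 / 1)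
    above = eventually-both (-3≤θ (½ * e) (half-pos e>0)) c-1+e≤-θ λ n → -3-upper (seq θ n) (c / 1) e e>0

  -- Any smallest eigenvalue θ lies below and above -3, which fixes c = 3; with s = 1 the rational
  -- factorisation is one over ℤ.
  Γ-not-integrable : ∀ t → ¬ Integrable 1 (Γ (suc (suc t)))
  Γ-not-integrable t (θ , c , (θ-eigen , θ-least) , ceiling , m , N , factor) = Lattice.Γ-not-represented {t} N gram
    where
    c≡3 : c ≡ ℤ.+ 3
    c≡3 = ceiling≡3 {θ} {c} (θ-least (fromℤ -[1+ 2 ]) (eigenvalue-3 t)) (eigenvalue≥-3 (suc (suc t)) θ θ-eigen) ceiling
    gram : ∀ x y → sumℤ (λ i → N i x ℤ.* N i y)
                 ≡ G.adjacencyMatrix (suc (suc t)) x y ℤ.+ ℤ.+ 3 ℤ.* G.identityMatrix (suc (suc t)) x y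
    gram x y = sym (subst (λ c → G.adjacencyMatrix (suc (suc t)) x y ℤ.+ c ℤ.* G.identityMatrix (suc (suc t)) x y ≡ sumℤ (λ i → N i x ℤ.* N i y)) c≡3
      (/1-injective {G.adjacencyMatrix (suc (suc t)) x y ℤ.+ c ℤ.* G.identityMatrix (suc (suc t)) x y} {sumℤ (λ i → N i x ℤ.* N i y)}
        (trans (factor x y) (ℚ.*-identityˡ (sumℤ (λ i → N i x ℤ.* N i y) / 1)))))

open import Data.Nat.Base using (_≤_; _+_; _*_)

theorem1p6 : (t : ℕ) → 2 ≤ t →
    Connected (Γ t)
    × SesquiRegular (Γ t) (16 * t) (t + 5) 2
    × IsSmallestEigenvalue (Γ t) (fromℤ -[1+ 2 ])
    × ¬ Integrable 1 (Γ t)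
theorem1p6 (suc (suc t)) _ =
  Combinatorics.Γ-connected (suc (suc t)) 0F ,
  Combinatorics.Γ-sesquiRegular (suc (suc t)) ,
  Spectrum.Γ-smallest-eigenvalue t ,
  Spectrum.Γ-not-integrable t
theorem1p6 1 (ℕ.s≤s ())
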